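{- Let $k$ be a positive integer. For every integer $n\geqslant\lceil k^2/2+2k+1\rceil$ there exists a $k$-prolific permutation $\sigma\in S_n$.
   Context: $S_n$ is the set of permutations of $[n]$. A permutation $\sigma\in S_n$ contains $\pi\in S_r$ ($\pi\preceq\sigma$) if there are indices $i_1<\dots<i_r$ with $\sigma(i_1)\cdots\sigma(i_r)$ in the same relative order as $\pi$; for $n>k\geqslant1$, $\sigma$ is $k$-prolific if $|\{\pi\in S_{n-k}:\pi\preceq\sigma\}|=\binom{n}{k}$. -}

module Defs where

open import Data.Nat using (ℕ; _∸_)
open import Data.Nat.Combinatorics using (_C_)
open import Data.Fin using (Fin; _<_)
open import Data.Fin.Permutation using (Permutation′; _⟨$⟩ʳ_)
open import Data.Product using (Σ; _×_)
open import Data.List using (List; length)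
open import Data.List.Relation.Unary.All using (All)
open import Data.List.Relation.Unary.Any using (Any)
open import Data.List.Relation.Unary.AllPairs using (AllPairs)
open import Relation.Binary.PropositionalEquality using (_≡_)
open import Relation.Nullary using (¬_)
open import Function.Bundles using (_⇔_)

Perm : ℕ → Set
Perm n = Permutation′ n

_≈ₚ_ : ∀ {n} → Perm n → Perm n → Set
π ≈ₚ τ = ∀ i → π ⟨$⟩ʳ i ≡ τ ⟨$⟩ʳ i

_⪯_ : ∀ {r n} → Perm r → Perm n → Set
_⪯_ {r} {n} π σ =
  Σ (Fin r → Fin n) λ e →
    (∀ i j → i < j → e i < e j) ×
    (∀ i j → (π ⟨$⟩ʳ i < π ⟨$⟩ʳ j) ⇔ (σ ⟨$⟩ʳ e i < σ ⟨$⟩ʳ e j))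

HasSize : ∀ {m} → (Perm m → Set) → ℕ → Set
HasSize {m} P c =
  Σ (List (Perm m)) λ L →
    (length L ≡ c) ×
    All P L ×
    AllPairs (λ π τ → ¬ (π ≈ₚ τ)) L ×
    (∀ π → P π → Any (λ τ → π ≈ₚ τ) L)

Prolific : (k n : ℕ) → Perm n → Set
Prolific k n σ = HasSize {n ∸ k} (λ π → π ⪯ σ) (n C k)

{-# OPTIONS --safe #-}

-- Call the least L¹-distance between two points (i , σ i) the breadth of σ.
--
-- Breadth ≥ k + 2 implies k-prolific.  If deleting the k-sets A ≠ B leaves the
-- same pattern, then matching the survivors gives an order-preserving partial
-- map φ from the complement of B onto the complement of A.  Up to symmetry some
-- point moves to the north-east under φ.  Deleted points account for every
-- displacement: φ moves p to the right by #{A left of φ p} − #{B left of p}, and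
-- likewise upwards.  Adding the horizontal step of a point w and the vertical
-- step of a point v gives at most k plus the number of points of A left of φ w and
-- below φ v; those of them that do not start a north-east chain are compensated
-- by points of B, because a φ-closed set contains at least as many points of B
-- as of A.  With w = v this bounds a step by k + 1 unless another north-east
-- point intrudes into its strips, and with w, v mutually intruding it shows that
-- w and v are at distance ≤ k.  Following intruders from the leftmost north-east
-- point therefore leads further and further to the right, which is absurd.
--
-- Construction.  Let s = 2c + 1.  List the values in 0, …, n−1 class by class
-- modulo s, each class in decreasing order, with the classes arranged as
-- c, 0, c+1, 1, …, 2c−1, c−1, 2c.  If h is c or c + 1 and n ≥ hs + c, the result
-- has breadth at least c + h + 1; for n = hs + c this is the lattice
-- packing of the torus by diamonds with one point removed.
module Submission where

open import Defs
open import Data.Nat using (ℕ; zero; suc; _+_; _*_; _∸_; _≤_; _<_; _/_; _%_; z≤n; s≤s; ∣_-_∣; _≤?_; _<?_)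
open import Data.Nat.Properties hiding (suc-injective)
open import Algebra.Properties.CommutativeMonoid.Sum +-0-commutativeMonoid using (sum; sum-cong-≗; ∑-distrib-+; sum-permute)
open import Algebra.Properties.CommutativeSemigroup +-commutativeSemigroup using (interchange)
open import Data.Empty using (⊥; ⊥-elim)
open import Data.Fin using (Fin; zero; suc; toℕ; fromℕ<; punchOut) renaming (_<_ to _<ᶠ_)
open import Data.Fin.Permutation using (_⟨$⟩ʳ_; _⟨$⟩ˡ_; inverseˡ; permutation; _∘ₚ_; reverse) renaming (id to idₚ)
open import Data.Fin.Properties using (any?; all?; toℕ<n; toℕ-injective; toℕ-fromℕ<; punchOut-injective; injective⇒≤; suc-injective; opposite-prop) renaming (_≟_ to _≟ᶠ_; <-cmp to <ᶠ-cmp)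
open import Data.List using (List; []; _∷_; [_]; _++_; map; length)
open import Data.List.Membership.Propositional using (_∈_)
open import Data.List.Membership.Propositional.Properties using (∈-map⁺; ∈-map⁻; ∈-++⁺ˡ; ∈-++⁺ʳ)
open import Data.List.Properties using (length-map; length-++)
open import Data.List.Relation.Binary.Disjoint.Propositional using (Disjoint)
open import Data.List.Relation.Unary.All using ([])
import Data.List.Relation.Unary.All as All
import Data.List.Relation.Unary.All.Properties as All
open import Data.List.Relation.Unary.AllPairs using ([]; _∷_)
import Data.List.Relation.Unary.AllPairs as AllPairs
import Data.List.Relation.Unary.AllPairs.Properties as AllPairs
open import Data.List.Relation.Unary.Any using (here)
import Data.List.Relation.Unary.Any as Any
import Data.List.Relation.Unary.Any.Properties as Any
open import Data.List.Relation.Unary.Unique.Propositional using (Unique)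
import Data.List.Relation.Unary.Unique.Propositional.Properties as Unique
open import Data.Nat.Combinatorics using (_C_; nCn≡1; nCk+nC[k+1]≡[n+1]C[k+1]; nCk≡nC[n∸k])
open import Data.Nat.Divisibility using (n∣m*n)
open import Data.Nat.DivMod
open import Data.Nat.Tactic.RingSolver using (solve-∀)
open import Data.Product using (Σ; _×_; _,_; proj₁; proj₂; ∃)
open import Data.Sum using (_⊎_; inj₁; inj₂)
open import Function using (_∘_; _⇔_; Equivalence; mk⇔)
open import Function.Definitions using (Injective)
open import Function.Properties.Equivalence using () renaming (sym to ⇔-sym; trans to ⇔-trans)
open import Relation.Binary using (tri<; tri≈; tri>)
open import Relation.Binary.PropositionalEquality using (_≡_; _≢_; refl; sym; trans; cong; cong₂; subst; subst₂)
open import Relation.Nullary using (¬_; Dec; yes; no; _×-dec_; _⊎-dec_; _→-dec_; ¬?)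

-- Linear arithmetic à la Farkas: s is the slack, and the equation is left to the ring solver.
linear : ∀ {l r L R} s → l ≤ r → L + r + s ≡ R + l → L ≤ R
linear {l} {r} {L} {R} s l≤r eq = +-cancelʳ-≤ r L R (begin
  L + r      ≤⟨ m≤m+n (L + r) s ⟩
  L + r + s  ≡⟨ eq ⟩
  R + l      ≤⟨ +-monoʳ-≤ R l≤r ⟩
  R + r      ∎)
  where open ≤-Reasoning

-- Indicators and counting by sums

⟦_⟧ : {P : Set} → Dec P → ℕ
⟦ yes _ ⟧ = 1
⟦ no _ ⟧ = 0

⟦⟧≤1 : {P : Set} (P? : Dec P) → ⟦ P? ⟧ ≤ 1
⟦⟧≤1 (yes _) = ≤-refl
⟦⟧≤1 (no _) = z≤n

⟦⟧-true : {P : Set} (P? : Dec P) → P → ⟦ P? ⟧ ≡ 1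
⟦⟧-true (yes _) p = refl
⟦⟧-true (no ¬p) p = ⊥-elim (¬p p)

⟦⟧-false : {P : Set} (P? : Dec P) → ¬ P → ⟦ P? ⟧ ≡ 0
⟦⟧-false (yes p) ¬p = ⊥-elim (¬p p)
⟦⟧-false (no _) ¬p = refl

⟦⟧-mono : {P Q : Set} (P? : Dec P) (Q? : Dec Q) → (P → Q) → ⟦ P? ⟧ ≤ ⟦ Q? ⟧
⟦⟧-mono (yes p) Q? P⇒Q = ≤-reflexive (sym (⟦⟧-true Q? (P⇒Q p)))
⟦⟧-mono (no _) Q? P⇒Q = z≤n

⟦⟧-cong : {P Q : Set} (P? : Dec P) (Q? : Dec Q) → (P → Q) → (Q → P) → ⟦ P? ⟧ ≡ ⟦ Q? ⟧
⟦⟧-cong P? Q? P⇒Q Q⇒P = ≤-antisym (⟦⟧-mono P? Q? P⇒Q) (⟦⟧-mono Q? P? Q⇒P)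

⟦⟧-⊎ : {P Q : Set} (P? : Dec P) (Q? : Dec Q) → ⟦ P? ⊎-dec Q? ⟧ ≤ ⟦ P? ⟧ + ⟦ Q? ⟧
⟦⟧-⊎ (yes _) Q? = s≤s z≤n
⟦⟧-⊎ (no _) (yes _) = ≤-refl
⟦⟧-⊎ (no _) (no _) = z≤n

sum-mono : ∀ {n} {u v : Fin n → ℕ} → (∀ i → u i ≤ v i) → sum u ≤ sum v
sum-mono {zero} u≤v = z≤n
sum-mono {suc n} u≤v = +-mono-≤ (u≤v zero) (sum-mono (u≤v ∘ suc))

sum-zero : ∀ {n} {u : Fin n → ℕ} → (∀ i → u i ≡ 0) → sum u ≡ 0
sum-zero {zero} u≡0 = refl
sum-zero {suc n} u≡0 = cong₂ _+_ (u≡0 zero) (sum-zero (u≡0 ∘ suc))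

sum≤size : ∀ {n} {u : Fin n → ℕ} → (∀ i → u i ≤ 1) → sum u ≤ n
sum≤size {zero} u≤1 = z≤n
sum≤size {suc n} u≤1 = +-mono-≤ (u≤1 zero) (sum≤size (u≤1 ∘ suc))

sum-point : ∀ {n} (p : Fin n) → sum (λ q → ⟦ q ≟ᶠ p ⟧) ≡ 1
sum-point {suc n} zero = cong suc (sum-zero {n} { λ i → ⟦ suc i ≟ᶠ zero ⟧} λ _ → refl)
sum-point (suc p) = trans
  (sum-cong-≗ λ i → ⟦⟧-cong (suc i ≟ᶠ suc p) (i ≟ᶠ p) (λ { refl → refl }) (cong suc))
  (sum-point p)

sum-below : ∀ n v → v ≤ n → sum {n} (λ q → ⟦ toℕ q <? v ⟧) ≡ v
sum-below n zero v≤n = sum-zero {n} λ i → ⟦⟧-false (toℕ i <? 0) λ ()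
sum-below (suc n) (suc v) (s≤s v≤n) = cong suc (trans
  (sum-cong-≗ {n} λ i → ⟦⟧-cong (suc (toℕ i) <? suc v) (toℕ i <? v) ≤-pred s≤s)
  (sum-below n v v≤n))

-- Coordinates of points and pairs of embeddings

coord : ∀ {n} → Perm n → Fin n → ℕ
coord X p = toℕ (X ⟨$⟩ʳ p)

coord-injective : ∀ {n} (X : Perm n) {p q} → coord X p ≡ coord X q → p ≡ q
coord-injective X {p} {q} eq =
  trans (sym (inverseˡ X)) (trans (cong (X ⟨$⟩ˡ_) (toℕ-injective eq)) (inverseˡ X))

count-coord-below : ∀ {n} (X : Perm n) v → v ≤ n → sum (λ p → ⟦ coord X p <? v ⟧) ≡ v
count-coord-below {n} X v v≤n =
  trans (sym (sum-permute (λ q → ⟦ toℕ q <? v ⟧) X)) (sum-below n v v≤n)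

-- The images of f and b partition Fin n, expressed through sums.
Partition : ∀ {r k n} → (Fin r → Fin n) → (Fin k → Fin n) → Set
Partition f b = ∀ w → sum w ≡ sum (w ∘ f) + sum (w ∘ b)

SameOrder : ∀ {r n} → Perm n → (f g : Fin r → Fin n) → Set
SameOrder X f g = ∀ i j → (coord X (f i) < coord X (f j)) ⇔ (coord X (g i) < coord X (g j))

argmin : ∀ {r} {P : Fin r → Set} → (∀ i → Dec (P i)) → (μ : Fin r → ℕ) → ∃ P →
         ∃ λ i → P i × (∀ j → P j → μ i ≤ μ j)
argmin {zero} P? μ (() , _)
argmin {suc r} {P} P? μ (i , Pi) with any? (P? ∘ suc)
argmin P? μ (zero , P0) | no ¬∃ = zero , P0 , λ { zero _ → ≤-refl ; (suc j) Pj → ⊥-elim (¬∃ (j , Pj)) }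
argmin P? μ (suc i , Pi) | no ¬∃ = ⊥-elim (¬∃ (i , Pi))
... | yes ∃P with argmin (P? ∘ suc) (μ ∘ suc) ∃P
... | j , Pj , min with P? zero
... | no ¬P0 = suc j , Pj , λ { zero P0 → ⊥-elim (¬P0 P0) ; (suc l) Pl → min l Pl }
... | yes P0 with ≤-total (μ zero) (μ (suc j))
... | inj₁ 0≤j = zero , P0 , λ { zero _ → ≤-refl ; (suc l) Pl → ≤-trans 0≤j (min l Pl) }
... | inj₂ j≤0 = suc j , Pj , λ { zero _ → j≤0 ; (suc l) Pl → min l Pl }

-- Displacement along one axis

module Axis {n r k : ℕ} (X : Perm n) (f g : Fin r → Fin n) (b a : Fin k → Fin n)
            (f-b : Partition f b) (g-a : Partition g a) (mono : SameOrder X f g) where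

  private
    x : Fin n → ℕ
    x = coord X

  x<n : ∀ p → x p < n
  x<n p = toℕ<n (X ⟨$⟩ʳ p)

  deletedBelow : (Fin k → Fin n) → ℕ → ℕ
  deletedBelow d v = sum λ j → ⟦ x (d j) <? v ⟧

  rank : ∀ p → sum (λ q → ⟦ x q <? x p ⟧) ≡ x p
  rank p = count-coord-below X (x p) (<⇒≤ (x<n p))

  -- A coordinate counts the points before it. By `mono` equally many kept points precede `f i` and
  -- `g i`, so the two coordinates differ only through deleted points.
  shift : ∀ i → x (g i) + deletedBelow b (x (f i)) ≡ x (f i) + deletedBelow a (x (g i))
  shift i = trans (cong (_+ B) (trans (sym (rank (g i))) (g-a _)))
    (trans (swap G A B) (sym (cong (_+ A) (trans (trans (sym (rank (f i))) (f-b _)) (cong (_+ B) F≡G)))))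
    where
    A = deletedBelow a (x (g i))
    B = deletedBelow b (x (f i))
    G = sum λ j → ⟦ x (g j) <? x (g i) ⟧
    F≡G : sum (λ j → ⟦ x (f j) <? x (f i) ⟧) ≡ G
    F≡G = sum-cong-≗ λ j → ⟦⟧-cong (x (f j) <? x (f i)) (x (g j) <? x (g i))
      (Equivalence.to (mono j i)) (Equivalence.from (mono j i))
    swap : ∀ s t u → s + t + u ≡ s + u + t
    swap = solve-∀

  step≤k : ∀ i → x (g i) ≤ x (f i) + k
  step≤k i = begin
    x (g i)                                ≤⟨ m≤m+n _ _ ⟩
    x (g i) + deletedBelow b (x (f i))     ≡⟨ shift i ⟩
    x (f i) + deletedBelow a (x (g i))     ≤⟨ +-monoʳ-≤ (x (f i)) (sum≤size λ j → ⟦⟧≤1 (x (a j) <? x (g i))) ⟩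
    x (f i) + k                            ∎
    where open ≤-Reasoning

  -- The second component is vacuous for points outside the image of f.
  Backward : Fin r → Fin n → Set
  Backward i p = (x p < x (f i)) × (∀ j → f j ≡ p → x (g j) ≤ x p)

  Backward? : ∀ i p → Dec (Backward i p)
  Backward? i p = (x p <? x (f i)) ×-dec all? (λ j → (f j ≟ᶠ p) →-dec (x (g j) ≤? x p))

  g-mono-≤ : ∀ i j → x (f i) ≤ x (f j) → x (g i) ≤ x (g j)
  g-mono-≤ i j fi≤fj = ≮⇒≥ λ gj<gi → <⇒≱ (Equivalence.from (mono j i) gj<gi) fi≤fj

  -- Were `f w` at or before `f i`, monotonicity would give `x (g w) ≤ x (g i) ≤ x (f i)`, against
  -- the last hypothesis.
  Backward-source : ∀ w i → x (g i) ≤ x (f i) → x (f i) < x (g w) → Backward w (f i)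
  Backward-source w i gi≤fi fi<gw =
    ≰⇒> (λ fw≤fi → <⇒≱ fi<gw (≤-trans (g-mono-≤ w i fw≤fi) gi≤fi)) ,
    λ j fj≡fi → ≤-trans (g-mono-≤ j i (≤-reflexive (cong x fj≡fi))) gi≤fi

  -- The image of such a point lies at or before it; applying the order-preserving map to this
  -- inequality shows that the image does not move forward either.
  Backward-closed : ∀ i j → Backward i (f j) → Backward i (g j)
  Backward-closed i j (fj<fi , back) =
    ≤-<-trans gj≤fj fj<fi ,
    λ l fl≡gj → g-mono-≤ l j (≤-trans (≤-reflexive (cong x fl≡gj)) gj≤fj)
    where
    gj≤fj = back j refl

  -- As `x` is a bijection onto the numbers below `n`, a strip holds as many points as it is wide.
  -- `no-crossing` uses this to turn strip counts into lengths.
  between : ∀ u v → u ≤ v → v ≤ n → u + sum (λ p → ⟦ (u ≤? x p) ×-dec (x p <? v) ⟧) ≡ v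
  between u v u≤v v≤n =
    trans (cong (_+ sum inside) (sym (count-coord-below X u (≤-trans u≤v v≤n))))
    (trans (sym (∑-distrib-+ (λ p → ⟦ x p <? u ⟧) inside))
    (trans (sum-cong-≗ λ p → pointwise (x p)) (count-coord-below X v v≤n)))
    where
    inside : Fin n → ℕ
    inside p = ⟦ (u ≤? x p) ×-dec (x p <? v) ⟧
    pointwise : ∀ t → ⟦ t <? u ⟧ + ⟦ (u ≤? t) ×-dec (t <? v) ⟧ ≡ ⟦ t <? v ⟧
    pointwise t with t <? u
    ... | yes t<u = trans (cong suc (⟦⟧-false ((u ≤? t) ×-dec (t <? v)) λ { (u≤t , _) → <⇒≱ t<u u≤t }))
                          (sym (⟦⟧-true (t <? v) (<-≤-trans t<u u≤v)))
    ... | no t≮u = ⟦⟧-cong ((u ≤? t) ×-dec (t <? v)) (t <? v) proj₂ (≮⇒≥ t≮u ,_)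

-- North-east moves and their exclusion

Breadth≥ : ∀ {n} → ℕ → Perm n → Perm n → Set
Breadth≥ d X Y = ∀ p q → p ≢ q →
  d ≤ ∣ coord X p - coord X q ∣ + ∣ coord Y p - coord Y q ∣

module NorthEast {n r k : ℕ} (X Y : Perm n) (f g : Fin r → Fin n) (b a : Fin k → Fin n)
                 (f-b : Partition f b) (g-a : Partition g a)
                 (monoˣ : SameOrder X f g) (monoʸ : SameOrder Y f g)
                 (far : Breadth≥ (k + 2) X Y) where

  private
    x y : Fin n → ℕ
    x = coord X
    y = coord Y
    module 𝕏 = Axis X f g b a f-b g-a monoˣ
    module 𝕐 = Axis Y f g b a f-b g-a monoʸ

  monotone-gap : ∀ {s t} → s ≤ t → s + ∣ s - t ∣ ≡ t
  monotone-gap {s} s≤t = trans (cong (s +_) (m≤n⇒∣m-n∣≡n∸m s≤t)) (m+[n∸m]≡n s≤t)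

  far-NE : ∀ p q → p ≢ q → x p ≤ x q → y p ≤ y q → x p + y p + (k + 2) ≤ x q + y q
  far-NE p q p≢q xp≤xq yp≤yq = begin
    x p + y p + (k + 2)                                ≤⟨ +-monoʳ-≤ (x p + y p) (far p q p≢q) ⟩
    x p + y p + (∣ x p - x q ∣ + ∣ y p - y q ∣)        ≡⟨ interchange (x p) (y p) _ _ ⟩
    (x p + ∣ x p - x q ∣) + (y p + ∣ y p - y q ∣)      ≡⟨ cong₂ _+_ (monotone-gap xp≤xq) (monotone-gap yp≤yq) ⟩
    x q + y q                                          ∎
    where open ≤-Reasoning

  far-SE : ∀ p q → p ≢ q → x p ≤ x q → y q ≤ y p → x p + y q + (k + 2) ≤ x q + y p
  far-SE p q p≢q xp≤xq yq≤yp = begin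
    x p + y q + (k + 2)                                ≤⟨ +-monoʳ-≤ (x p + y q) (far p q p≢q) ⟩
    x p + y q + (∣ x p - x q ∣ + ∣ y p - y q ∣)        ≡⟨ cong (λ e → x p + y q + (∣ x p - x q ∣ + e)) (∣-∣-comm (y p) (y q)) ⟩
    x p + y q + (∣ x p - x q ∣ + ∣ y q - y p ∣)        ≡⟨ interchange (x p) (y q) _ _ ⟩
    (x p + ∣ x p - x q ∣) + (y q + ∣ y q - y p ∣)      ≡⟨ cong₂ _+_ (monotone-gap xp≤xq) (monotone-gap yq≤yp) ⟩
    x q + y p                                          ∎
    where open ≤-Reasoning

  Closed : Fin r → Fin r → Fin n → Set
  Closed w v p = 𝕏.Backward w p ⊎ 𝕐.Backward v p

  Closed? : ∀ w v p → Dec (Closed w v p)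
  Closed? w v p = 𝕏.Backward? w p ⊎-dec 𝕐.Backward? v p

  Closed-closed : ∀ w v j → Closed w v (f j) → Closed w v (g j)
  Closed-closed w v j (inj₁ t) = inj₁ (𝕏.Backward-closed w j t)
  Closed-closed w v j (inj₂ t) = inj₂ (𝕐.Backward-closed v j t)

  -- By closedness at least as many points of `g` as of `f` lie in the set. Counting it along both
  -- partitions, it contains at most as many points of `a` as of `b`, and each such `b j` lies left
  -- of `f w` or below `f v`.
  count-Closed : ∀ w v → sum (λ j → ⟦ Closed? w v (a j) ⟧)
                       ≤ 𝕏.deletedBelow b (x (f w)) + 𝕐.deletedBelow b (y (f v))
  count-Closed w v = ≤-trans a≤b (begin
    sum (λ j → ⟦ Closed? w v (b j) ⟧)
      ≤⟨ sum-mono (λ j → ≤-trans (⟦⟧-⊎ (𝕏.Backward? w (b j)) (𝕐.Backward? v (b j)))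
           (+-mono-≤ (⟦⟧-mono (𝕏.Backward? w (b j)) (x (b j) <? x (f w)) proj₁)
                     (⟦⟧-mono (𝕐.Backward? v (b j)) (y (b j) <? y (f v)) proj₁))) ⟩
    sum (λ j → ⟦ x (b j) <? x (f w) ⟧ + ⟦ y (b j) <? y (f v) ⟧)
      ≡⟨ ∑-distrib-+ (λ j → ⟦ x (b j) <? x (f w) ⟧) _ ⟩
    𝕏.deletedBelow b (x (f w)) + 𝕐.deletedBelow b (y (f v)) ∎)
    where
    open ≤-Reasoning
    c : Fin n → ℕ
    c p = ⟦ Closed? w v p ⟧
    f≤g : sum (c ∘ f) ≤ sum (c ∘ g)
    f≤g = sum-mono λ j → ⟦⟧-mono (Closed? w v (f j)) (Closed? w v (g j)) (Closed-closed w v j)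
    a≤b : sum (c ∘ a) ≤ sum (c ∘ b)
    a≤b = +-cancelˡ-≤ (sum (c ∘ g)) _ _ (begin
      sum (c ∘ g) + sum (c ∘ a) ≡⟨ g-a c ⟨
      sum c                     ≡⟨ f-b c ⟩
      sum (c ∘ f) + sum (c ∘ b) ≤⟨ +-monoˡ-≤ (sum (c ∘ b)) f≤g ⟩
      sum (c ∘ g) + sum (c ∘ b) ∎)

  -- Add the two `shift` equations. Counting every `a j` once costs `k`; a second count occurs only
  -- if `a j` is both left of `g w` and below `g v`. Then it is either closed, and offset by the `b`
  -- terms via `count-Closed`, or charged to the weight `e`.
  steps≤ : ∀ w v (e : Fin n → ℕ) →
    (∀ p → x p < x (g w) → y p < y (g v) → Closed w v p ⊎ (1 ≤ e p)) →
    x (g w) + y (g v) ≤ x (f w) + y (f v) + (k + sum e)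
  steps≤ w v e cover = +-cancelʳ-≤ (Bx + By) _ _ (begin
    x (g w) + y (g v) + (Bx + By)             ≡⟨ interchange (x (g w)) (y (g v)) Bx By ⟩
    (x (g w) + Bx) + (y (g v) + By)           ≡⟨ cong₂ _+_ (𝕏.shift w) (𝕐.shift v) ⟩
    (x (f w) + Ax) + (y (f v) + Ay)           ≡⟨ interchange (x (f w)) (y (f v)) Ax Ay ⟨
    x (f w) + y (f v) + (Ax + Ay)             ≤⟨ +-monoʳ-≤ (x (f w) + y (f v)) Ax+Ay≤ ⟩
    x (f w) + y (f v) + (k + (Bx + By + E))   ≡⟨ shuffle (x (f w) + y (f v)) k (Bx + By) E ⟩
    x (f w) + y (f v) + (k + E) + (Bx + By)   ∎)
    where
    open ≤-Reasoning
    Ax = 𝕏.deletedBelow a (x (g w))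
    Ay = 𝕐.deletedBelow a (y (g v))
    Bx = 𝕏.deletedBelow b (x (f w))
    By = 𝕐.deletedBelow b (y (f v))
    E = sum e
    shuffle : ∀ s t u v → s + (t + (u + v)) ≡ s + (t + v) + u
    shuffle = solve-∀
    ones : Fin k → ℕ
    ones _ = 1
    pointwise : ∀ j → ⟦ x (a j) <? x (g w) ⟧ + ⟦ y (a j) <? y (g v) ⟧
                    ≤ 1 + (⟦ Closed? w v (a j) ⟧ + e (a j))
    pointwise j with x (a j) <? x (g w) | y (a j) <? y (g v)
    ... | no _ | Q = ≤-trans (⟦⟧≤1 Q) (s≤s z≤n)
    ... | yes _ | no _ = s≤s z≤n
    ... | yes p | yes q with cover (a j) p q
    ... | inj₁ t = s≤s (≤-trans (≤-reflexive (sym (⟦⟧-true (Closed? w v (a j)) t))) (m≤m+n _ _))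
    ... | inj₂ t = s≤s (≤-trans t (m≤n+m _ _))
    Ax+Ay≤ : Ax + Ay ≤ k + (Bx + By + E)
    Ax+Ay≤ = begin
      Ax + Ay
        ≡⟨ ∑-distrib-+ (λ j → ⟦ x (a j) <? x (g w) ⟧) _ ⟨
      sum (λ j → ⟦ x (a j) <? x (g w) ⟧ + ⟦ y (a j) <? y (g v) ⟧)
        ≤⟨ sum-mono pointwise ⟩
      sum (λ j → 1 + (⟦ Closed? w v (a j) ⟧ + e (a j)))
        ≡⟨ ∑-distrib-+ ones _ ⟩
      sum ones + sum (λ j → ⟦ Closed? w v (a j) ⟧ + e (a j))
        ≤⟨ +-mono-≤ (sum≤size {k} λ _ → ≤-refl) (≤-reflexive (∑-distrib-+ (λ j → ⟦ Closed? w v (a j) ⟧) _)) ⟩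
      k + (sum (λ j → ⟦ Closed? w v (a j) ⟧) + sum (e ∘ a))
        ≤⟨ +-monoʳ-≤ k (+-mono-≤ (count-Closed w v) (≤-trans (m≤n+m _ (sum (e ∘ g))) (≤-reflexive (sym (g-a e))))) ⟩
      k + (Bx + By + E) ∎

  NE : Fin r → Set
  NE i = (x (f i) < x (g i)) × (y (f i) < y (g i))

  NE? : ∀ i → Dec (NE i)
  NE? i = (x (f i) <? x (g i)) ×-dec (y (f i) <? y (g i))

  -- A point `f i` that fails to move right or up is backward along that axis by `Backward-source`.
  -- A point outside the image of `f` is backward as soon as it lies left of `f w` or below `f v`.
  dichotomy : ∀ w v p → x p < x (g w) → y p < y (g v) →
    Closed w v p ⊎ (∃ λ i → f i ≡ p × NE i) ⊎ (x (f w) ≤ x p × y (f v) ≤ y p)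
  dichotomy w v p xp<gw yp<gv with any? (λ i → f i ≟ᶠ p)
  ... | yes (i , refl) with x (f i) <? x (g i) | y (f i) <? y (g i)
  ...   | yes right | yes up = inj₂ (inj₁ (i , refl , right , up))
  ...   | no ¬right | _ = inj₁ (inj₁ (𝕏.Backward-source w i (≮⇒≥ ¬right) xp<gw))
  ...   | yes _ | no ¬up = inj₁ (inj₂ (𝕐.Backward-source v i (≮⇒≥ ¬up) yp<gv))
  dichotomy w v p xp<gw yp<gv | no ¬∃ with x p <? x (f w) | y p <? y (f v)
  ... | yes xp< | _ = inj₁ (inj₁ (xp< , λ i fi≡p → ⊥-elim (¬∃ (i , fi≡p))))
  ... | no _ | yes yp< = inj₁ (inj₂ (yp< , λ i fi≡p → ⊥-elim (¬∃ (i , fi≡p))))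
  ... | no xp≮ | no yp≮ = inj₂ (inj₂ (≮⇒≥ xp≮ , ≮⇒≥ yp≮))

  x≢ : ∀ {p q} → x p < x q → p ≢ q
  x≢ lt refl = <-irrefl refl lt

  y≢ : ∀ {p q} → y p < y q → p ≢ q
  y≢ lt refl = <-irrefl refl lt

  -- A step has L¹-length at most 2k, too short for a third point in its bounding box.
  box-empty : ∀ w p → p ≢ f w → x (f w) ≤ x p → y (f w) ≤ y p →
              x p < x (g w) → y p < y (g w) → ⊥
  box-empty w p p≢fw fw≤p fw≤p′ p<gw p<gw′ = 1+n≰n {0}
    (linear 3 (+-mono-≤ (+-mono-≤ (far-NE (f w) p (p≢fw ∘ sym) fw≤p fw≤p′)
                                  (far-NE p (g w) (x≢ p<gw) (<⇒≤ p<gw) (<⇒≤ p<gw′)))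
                        (+-mono-≤ (𝕏.step≤k w) (𝕐.step≤k w)))
      (eq (x (f w)) (y (f w)) (x p) (y p) (x (g w)) (y (g w)) k))
    where
    eq : ∀ a b c d e f k → 1 + 0 + ((c + d) + (e + f) + ((a + k) + (b + k))) + 3
       ≡ 0 + ((a + b + (k + 2)) + (c + d + (k + 2)) + (e + f))
    eq = solve-∀

  -- The box with corners `f w` and `f v` is no wider than the step of `w` and no higher than that
  -- of `v`, so at most `k` each way; a third point in it would be at least `k + 2` from both
  -- corners.
  crossing-box-empty : ∀ w v p → x (f w) ≤ x p → x p < x (f v) → y (f v) ≤ y p → y p < y (f w) →
                       x (f v) ≤ x (g w) → y (f w) ≤ y (g v) → ⊥
  crossing-box-empty w v p fw≤p p<fv fv≤p p<fw fv≤gw fw≤gv = 1+n≰n {0}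
    (linear 3 (+-mono-≤ (+-mono-≤ (far-SE (f w) p (y≢ p<fw ∘ sym) fw≤p (<⇒≤ p<fw))
                                  (far-SE p (f v) (x≢ p<fv) (<⇒≤ p<fv) fv≤p))
                        (+-mono-≤ (≤-trans fv≤gw (𝕏.step≤k w)) (≤-trans fw≤gv (𝕐.step≤k v))))
      (eq (x (f w)) (y (f w)) (x p) (y p) (x (f v)) (y (f v)) k))
    where
    eq : ∀ a b c d e f k → 1 + 0 + ((c + b) + (e + d) + ((a + k) + (f + k))) + 3
       ≡ 0 + ((a + d + (k + 2)) + (c + f + (k + 2)) + (e + b))
    eq = solve-∀

  -- Only `f w` itself has to be charged to `e`, so `steps≤` bounds the L¹-length of the step by
  -- `k + 1`, one short of the assumed breadth.
  no-isolated : ∀ w → NE w →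
    (∀ i → NE i → f i ≢ f w → x (f i) < x (g w) → y (f i) < y (g w) → ⊥) → ⊥
  no-isolated w (right , up) isolated = 1+n≰n {0}
    (linear 0 (+-mono-≤ (steps≤ w w e cover) (far-NE (f w) (g w) (x≢ right) (<⇒≤ right) (<⇒≤ up)))
      (trans (cong (λ s → 1 + 0 + (x (f w) + y (f w) + (k + s) + (x (g w) + y (g w))) + 0) (sum-point (f w)))
             (eq (x (f w)) (y (f w)) (x (g w)) (y (g w)) k)))
    where
    eq : ∀ a b c d k → 1 + 0 + (a + b + (k + 1) + (c + d)) + 0
       ≡ 0 + (c + d + (a + b + (k + 2)))
    eq = solve-∀
    e : Fin n → ℕ
    e p = ⟦ p ≟ᶠ f w ⟧
    cover : ∀ p → x p < x (g w) → y p < y (g w) → Closed w w p ⊎ (1 ≤ e p)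
    cover p p<gw p<gw′ with p ≟ᶠ f w
    ... | yes _ = inj₂ ≤-refl
    ... | no p≢fw with dichotomy w w p p<gw p<gw′
    ...   | inj₁ closed = inj₁ closed
    ...   | inj₂ (inj₁ (i , refl , ne)) = ⊥-elim (isolated i ne p≢fw p<gw p<gw′)
    ...   | inj₂ (inj₂ (fw≤p , fw≤p′)) = ⊥-elim (box-empty w p p≢fw fw≤p fw≤p′ p<gw p<gw′)

  -- The weight `e` counts the columns from `f v` to `g w` and the rows from `f w` to `g v`. Its sum
  -- is the part of the two steps beyond the other point, so `steps≤` leaves at most `k` for the
  -- distance between `f w` and `f v`.
  no-crossing : ∀ w v →
    x (f w) < x (f v) → x (f v) < x (g w) → y (f v) < y (f w) → y (f w) < y (g v) →
    (∀ i → NE i → x (f i) < x (f w) → y (f i) < y (f w) → ⊥) →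
    (∀ i → NE i → x (f i) < x (f v) → y (f i) < y (f v) → ⊥) → ⊥
  no-crossing w v fw<fv fv<gw fv<fw fw<gv w-minimal v-minimal = 1+n≰n {0}
    (linear 1 (+-mono-≤ (+-mono-≤ (steps≤ w v e cover)
                                  (far-SE (f w) (f v) (x≢ fw<fv) (<⇒≤ fw<fv) (<⇒≤ fv<fw)))
                        (≤-reflexive sums))
      (eq (x (f w)) (y (f w)) (x (f v)) (y (f v)) (x (g w)) (y (g v)) (sum e) k))
    where
    eq : ∀ a b c d e f s k → 1 + 0 + (a + d + (k + s) + (c + b) + (e + f)) + 1
       ≡ 0 + (e + f + (a + d + (k + 2)) + ((c + b) + s))
    eq = solve-∀
    eˣ eʸ e : Fin n → ℕ
    eˣ p = ⟦ (x (f v) ≤? x p) ×-dec (x p <? x (g w)) ⟧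
    eʸ p = ⟦ (y (f w) ≤? y p) ×-dec (y p <? y (g v)) ⟧
    e p = eˣ p + eʸ p
    sums : x (f v) + y (f w) + sum e ≡ x (g w) + y (g v)
    sums = trans (cong (x (f v) + y (f w) +_) (∑-distrib-+ eˣ eʸ))
      (trans (interchange (x (f v)) (y (f w)) (sum eˣ) (sum eʸ))
        (cong₂ _+_ (𝕏.between (x (f v)) (x (g w)) (<⇒≤ fv<gw) (<⇒≤ (𝕏.x<n (g w))))
                   (𝕐.between (y (f w)) (y (g v)) (<⇒≤ fw<gv) (<⇒≤ (𝕐.x<n (g v))))))
    cover : ∀ p → x p < x (g w) → y p < y (g v) → Closed w v p ⊎ (1 ≤ e p)
    cover p p<gw p<gv with x (f v) ≤? x p | y (f w) ≤? y p
    ... | yes fv≤p | _ = inj₂ (≤-trans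
            (≤-reflexive (sym (⟦⟧-true (yes fv≤p ×-dec (x p <? x (g w))) (fv≤p , p<gw)))) (m≤m+n _ _))
    ... | no _ | yes fw≤p = inj₂ (≤-trans
            (≤-reflexive (sym (⟦⟧-true (yes fw≤p ×-dec (y p <? y (g v))) (fw≤p , p<gv)))) (m≤n+m _ _))
    ... | no fv≰p | no fw≰p with dichotomy w v p p<gw p<gv
    ...   | inj₁ closed = inj₁ closed
    -- The two minimality assumptions push a north-east point outside both strips into the box
    -- between `f w` and `f v`.
    ...   | inj₂ (inj₁ (i , refl , ne)) = ⊥-elim (crossing-box-empty w v p
              (≮⇒≥ λ p<fw → w-minimal i ne p<fw (≰⇒> fw≰p)) (≰⇒> fv≰p)
              (≮⇒≥ λ p<fv → v-minimal i ne (≰⇒> fv≰p) p<fv) (≰⇒> fw≰p)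
              (<⇒≤ fv<gw) (<⇒≤ fw<gv))
    ...   | inj₂ (inj₂ (fw≤p , fv≤p)) = ⊥-elim (crossing-box-empty w v p
              fw≤p (≰⇒> fv≰p) fv≤p (≰⇒> fw≰p) (<⇒≤ fv<gw) (<⇒≤ fw<gv))

  -- The invariant of the walk: it forces every intruder into the strips of `i` to start no further
  -- left than `f i`.
  Clear : Fin r → Set
  Clear i = ∀ j → NE j → x (f j) < x (f i) → y (g i) ≤ y (f j)

  Intruder : Fin r → Fin r → Set
  Intruder i j = NE j × (f j ≢ f i) × (x (f j) < x (g i)) × (y (f j) < y (g i))

  Intruder? : ∀ i j → Dec (Intruder i j)
  Intruder? i j = NE? j ×-dec ¬? (f j ≟ᶠ f i) ×-dec (x (f j) <? x (g i)) ×-dec (y (f j) <? y (g i))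

  -- An intruder exists by `no-isolated`. The walk continues not with it but with the lowest
  -- north-east start in the columns before `g i`; being lowest is what makes `v` clear again.
  next-Clear : ∀ i → NE i → Clear i → ∃ λ v → NE v × Clear v × (x (f i) < x (f v))
  next-Clear i NEi clear with any? (Intruder? i)
  ... | no ¬intruder = ⊥-elim (no-isolated i NEi
          λ j ne j≢i j<gi j<gi′ → ¬intruder (j , ne , j≢i , j<gi , j<gi′))
  ... | yes (j , NEj , j≢i , j<gi , j<gi′)
      with argmin (λ l → NE? l ×-dec (x (f l) <? x (g i))) (y ∘ f) (j , NEj , j<gi)
  ... | v , (NEv , v<gi) , lowest = v , NEv , clear-v , fi<fv
    where
    i≤j : x (f i) ≤ x (f j)
    i≤j = ≮⇒≥ λ j<i → <⇒≱ j<gi′ (clear j NEj j<i)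
    -- The intruder `j` is not left of `f i` and cannot lie in the box of the step, so it is below
    -- `f i`; and `v` is no higher.
    fv<fi : y (f v) < y (f i)
    fv<fi = ≤-<-trans (lowest j (NEj , j<gi))
      (≰⇒> λ i≤j′ → box-empty i (f j) j≢i i≤j i≤j′ j<gi j<gi′)
    fi<fv : x (f i) < x (f v)
    fi<fv = ≤∧≢⇒< (≮⇒≥ λ v<i → <⇒≱ (<-trans fv<fi (proj₂ NEi)) (clear v NEv v<i))
                  (λ eq → y≢ fv<fi (sym (coord-injective X eq)))
    v-minimal : ∀ l → NE l → x (f l) < x (f v) → y (f l) < y (f v) → ⊥
    v-minimal l NEl l<v l<v′ = <⇒≱ l<v′ (lowest l (NEl , <-trans l<v v<gi))
    clear-v : Clear v
    clear-v l NEl l<v = ≮⇒≥ contradict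
      where
      contradict : y (f l) < y (g v) → ⊥
      -- The leftmost north-east start `w` below `g v` decides which pair crosses. If it is left of
      -- `f i`, clearness of `i` puts `f i` below `f w`, hence below `g v`, and `i` crosses `v`.
      -- Otherwise `g w` is at least as far right as `g i`, hence beyond `f v`, and `w` crosses `v`.
      contradict l<gv with argmin (λ m → NE? m ×-dec (y (f m) <? y (g v))) (x ∘ f) (l , NEl , l<gv)
      ... | w , (NEw , w<gv) , leftmost with x (f w) <? x (f i)
      ...   | yes w<i = no-crossing i v fi<fv v<gi fv<fi
                (<-trans (<-≤-trans (proj₂ NEi) (clear w NEw w<i)) w<gv)
                (λ m NEm m<i m<i′ → <⇒≱ (<-trans m<i′ (proj₂ NEi)) (clear m NEm m<i))
                v-minimal
      ...   | no w≮i = no-crossing w v w<v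
                (<-≤-trans v<gi (𝕏.g-mono-≤ i w (≮⇒≥ w≮i)))
                (≤∧≢⇒< (lowest w (NEw , <-trans w<v v<gi)) λ eq → x≢ w<v (sym (coord-injective Y eq)))
                w<gv
                (λ m NEm m<w m<w′ → <⇒≱ m<w (leftmost m (NEm , <-trans m<w′ w<gv)))
                v-minimal
        where
        w<v : x (f w) < x (f v)
        w<v = ≤-<-trans (leftmost l (NEl , l<gv)) l<v

  -- Each passage to the next clear point raises `x (f i)`, so `fuel` bounds the columns that
  -- remain.
  no-Clear : ∀ fuel i → NE i → Clear i → n ≤ x (f i) + fuel → ⊥
  no-Clear zero i NEi clear n≤ = <⇒≱ (𝕏.x<n (f i)) (≤-trans n≤ (≤-reflexive (+-identityʳ _)))
  no-Clear (suc fuel) i NEi clear n≤ with next-Clear i NEi clear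
  ... | v , NEv , clear-v , i<v = no-Clear fuel v NEv clear-v
    (≤-trans n≤ (≤-trans (≤-reflexive (+-suc _ fuel)) (+-monoˡ-≤ fuel i<v)))

  no-NE : ∀ i → ¬ NE i
  no-NE i NEi with argmin NE? (x ∘ f) (i , NEi)
  ... | j , NEj , leftmost =
    -- For the leftmost north-east point, `Clear` holds vacuously.
    no-Clear n j NEj (λ l NEl l<j → ⊥-elim (<⇒≱ l<j (leftmost l NEl))) (m≤n+m n (x (f j)))

-- Reflection and uniqueness of the embedding

coord-reverse : ∀ {n} (Y : Perm n) p → suc (coord Y p) + coord (Y ∘ₚ reverse) p ≡ n
coord-reverse Y p = trans (cong (suc (coord Y p) +_) (opposite-prop (Y ⟨$⟩ʳ p))) (m+[n∸m]≡n (toℕ<n (Y ⟨$⟩ʳ p)))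

reverse-antitone : ∀ {n} (Y : Perm n) p q →
  coord Y p < coord Y q → coord (Y ∘ₚ reverse) q < coord (Y ∘ₚ reverse) p
reverse-antitone Y p q lt = linear 0
  (+-mono-≤ lt (≤-reflexive (trans (coord-reverse Y q) (sym (coord-reverse Y p)))))
  (eq (coord Y p) (coord Y q) (coord (Y ∘ₚ reverse) p) (coord (Y ∘ₚ reverse) q))
  where
  eq : ∀ a b a′ b′ → suc b′ + (b + (suc a + a′)) + 0 ≡ a′ + (suc a + (suc b + b′))
  eq = solve-∀

reverse-antitone⁻¹ : ∀ {n} (Y : Perm n) p q →
  coord (Y ∘ₚ reverse) q < coord (Y ∘ₚ reverse) p → coord Y p < coord Y q
reverse-antitone⁻¹ Y p q lt = linear 0
  (+-mono-≤ lt (≤-reflexive (trans (coord-reverse Y p) (sym (coord-reverse Y q)))))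
  (eq (coord Y p) (coord Y q) (coord (Y ∘ₚ reverse) p) (coord (Y ∘ₚ reverse) q))
  where
  eq : ∀ a b a′ b′ → suc a + (a′ + (suc b + b′)) + 0 ≡ b + (suc b′ + (suc a + a′))
  eq = solve-∀

reverse-SameOrder : ∀ {r n} (Y : Perm n) {f g : Fin r → Fin n} →
  SameOrder Y f g → SameOrder (Y ∘ₚ reverse) f g
reverse-SameOrder Y {f} {g} mono i j = mk⇔
  (reverse-antitone Y (g j) (g i) ∘ Equivalence.to (mono j i) ∘ reverse-antitone⁻¹ Y (f j) (f i))
  (reverse-antitone Y (f j) (f i) ∘ Equivalence.from (mono j i) ∘ reverse-antitone⁻¹ Y (g j) (g i))

-- Adding `s + t` to both `s′` and `t′` gives `m + t` and `m + s`.
∣-∣-complement : ∀ {m} s s′ t t′ → s + s′ ≡ m → t + t′ ≡ m → ∣ s′ - t′ ∣ ≡ ∣ s - t ∣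
∣-∣-complement {m} s s′ t t′ s+s′ t+t′ =
  trans (sym (∣m+n-m+o∣≡∣n-o∣ (s + t) s′ t′))
  (trans (cong₂ ∣_-_∣ (trans (eq₁ s t s′) (cong (_+ t) s+s′)) (trans (eq₂ s t t′) (cong (_+ s) t+t′)))
  (trans (∣m+n-m+o∣≡∣n-o∣ m t s) (∣-∣-comm t s)))
  where
  eq₁ : ∀ s t u → s + t + u ≡ s + u + t
  eq₁ = solve-∀
  eq₂ : ∀ s t u → s + t + u ≡ t + u + s
  eq₂ = solve-∀

reverse-Breadth≥ : ∀ {n d} (X Y : Perm n) → Breadth≥ d X Y → Breadth≥ d X (Y ∘ₚ reverse)
reverse-Breadth≥ X Y far p q p≢q = subst (λ e → _ ≤ ∣ coord X p - coord X q ∣ + e)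
  (sym (∣-∣-complement (suc (coord Y p)) _ (suc (coord Y q)) _ (coord-reverse Y p) (coord-reverse Y q)))
  (far p q p≢q)

module _ {n r k : ℕ} (X Y : Perm n) (far : Breadth≥ (k + 2) X Y) where

  -- A downward move becomes an upward one after reflecting `Y`, and equal heights would mean equal
  -- points.
  no-rightward : (f g : Fin r → Fin n) (b a : Fin k → Fin n) → Partition f b → Partition g a →
    SameOrder X f g → SameOrder Y f g → ∀ i → ¬ (coord X (f i) < coord X (g i))
  no-rightward f g b a f-b g-a monoˣ monoʸ i right with <-cmp (coord Y (f i)) (coord Y (g i))
  ... | tri< up _ _ = NorthEast.no-NE X Y f g b a f-b g-a monoˣ monoʸ far i (right , up)
  ... | tri≈ _ level _ = <-irrefl (cong (coord X) (coord-injective Y level)) right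
  ... | tri> _ _ down = NorthEast.no-NE X (Y ∘ₚ reverse) f g b a f-b g-a monoˣ
    (reverse-SameOrder Y monoʸ) (reverse-Breadth≥ X Y far) i
    (right , reverse-antitone Y (g i) (f i) down)

  -- A leftward move is a rightward one with `f` and `g` exchanged, so no `X`-coordinate changes.
  embeddings-agree : (f g : Fin r → Fin n) (b a : Fin k → Fin n) → Partition f b → Partition g a →
    SameOrder X f g → SameOrder Y f g → ∀ i → f i ≡ g i
  embeddings-agree f g b a f-b g-a monoˣ monoʸ i = coord-injective X (≤-antisym
    (≮⇒≥ (no-rightward g f a b g-a f-b (λ i j → ⇔-sym (monoˣ i j)) (λ i j → ⇔-sym (monoʸ i j)) i))
    (≮⇒≥ (no-rightward f g b a f-b g-a monoˣ monoʸ i)))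

-- Deletions of k positions

data Selection : (r k n : ℕ) → Set where
  done : Selection 0 0 0
  keep : ∀ {r k n} → Selection r k n → Selection (suc r) k (suc n)
  drop : ∀ {r k n} → Selection r k n → Selection r (suc k) (suc n)

kept : ∀ {r k n} → Selection r k n → Fin r → Fin n
kept (keep s) zero = zero
kept (keep s) (suc i) = suc (kept s i)
kept (drop s) i = suc (kept s i)

dropped : ∀ {r k n} → Selection r k n → Fin k → Fin n
dropped (keep s) j = suc (dropped s j)
dropped (drop s) zero = zero
dropped (drop s) (suc j) = suc (dropped s j)

kept-dropped : ∀ {r k n} (s : Selection r k n) → Partition (kept s) (dropped s)
kept-dropped done w = refl
kept-dropped (keep s) w = trans (cong (w zero +_) (kept-dropped s (w ∘ suc))) (sym (+-assoc (w zero) _ _))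
kept-dropped (drop s) w = trans (cong (w zero +_) (kept-dropped s (w ∘ suc)))
  (eq (w zero) (sum (w ∘ suc ∘ kept s)) (sum (w ∘ suc ∘ dropped s)))
  where
  eq : ∀ s t u → s + (t + u) ≡ t + (s + u)
  eq = solve-∀

kept-mono : ∀ {r k n} (s : Selection r k n) i j → i <ᶠ j → kept s i <ᶠ kept s j
kept-mono (keep s) zero (suc j) _ = s≤s z≤n
kept-mono (keep s) (suc i) (suc j) (s≤s i<j) = s≤s (kept-mono s i j i<j)
kept-mono (drop s) i j i<j = s≤s (kept-mono s i j i<j)

kept-injective : ∀ {r k n} (s t : Selection r k n) → (∀ i → kept s i ≡ kept t i) → s ≡ t
kept-injective done done eq = refl
kept-injective (keep s) (keep t) eq = cong keep (kept-injective s t (suc-injective ∘ eq ∘ suc))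
kept-injective (drop s) (drop t) eq = cong drop (kept-injective s t (suc-injective ∘ eq))
kept-injective (keep s) (drop t) eq with () ← eq zero
kept-injective (drop s) (keep t) eq with () ← eq zero

StrictlyIncreasing : ∀ {r n} → (Fin r → Fin n) → Set
StrictlyIncreasing e = ∀ i j → i <ᶠ j → e i <ᶠ e j

increasing-reflects : ∀ {r n} {e : Fin r → Fin n} → StrictlyIncreasing e →
                      ∀ i j → e i <ᶠ e j → i <ᶠ j
increasing-reflects inc i j ei<ej with <ᶠ-cmp i j
... | tri< i<j _ _ = i<j
... | tri≈ _ refl _ = ⊥-elim (<-irrefl refl ei<ej)
... | tri> _ _ j<i = ⊥-elim (<-asym ei<ej (inc j i j<i))

increasing-injective : ∀ {r n} {e : Fin r → Fin n} → StrictlyIncreasing e → Injective _≡_ _≡_ e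
increasing-injective inc {i} {j} eq with <ᶠ-cmp i j
... | tri< i<j _ _ = ⊥-elim (<-irrefl (cong toℕ eq) (inc i j i<j))
... | tri≈ _ i≡j _ = i≡j
... | tri> _ _ j<i = ⊥-elim (<-irrefl (cong toℕ (sym eq)) (inc j i j<i))

predecessor : ∀ {n} (p : Fin (suc n)) → 0 < toℕ p → ∃ λ q → p ≡ suc q
predecessor (suc p) _ = p , refl

-- Position 0 is kept exactly when `e zero` is `zero`. All remaining values are then positive and
-- are lowered by one for the recursion.
selection : ∀ {r k n} → r + k ≡ n → (e : Fin r → Fin n) → StrictlyIncreasing e →
            ∃ λ (s : Selection r k n) → ∀ i → kept s i ≡ e i
selection {zero} {zero} {zero} _ e inc = done , λ ()
selection {zero} {suc k} {suc n} eq e inc with selection {zero} {k} {n} (cong (_∸ 1) eq) (λ ()) (λ ())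
... | s , _ = drop s , λ ()
selection {suc r} {k} {suc n} eq e inc with e zero in e0
... | zero = keep (proj₁ rec) , λ { zero → sym e0 ; (suc i) → trans (cong suc (proj₂ rec i)) (sym (e≡ i)) }
  where
  pos : ∀ i → 0 < toℕ (e (suc i))
  pos i = subst (λ z → toℕ z < toℕ (e (suc i))) e0 (inc zero (suc i) (s≤s z≤n))
  e′ : Fin r → Fin n
  e′ i = proj₁ (predecessor (e (suc i)) (pos i))
  e≡ : ∀ i → e (suc i) ≡ suc (e′ i)
  e≡ i = proj₂ (predecessor (e (suc i)) (pos i))
  rec = selection {r} {k} {n} (cong (_∸ 1) eq) e′ λ i j i<j →
    ≤-pred (subst₂ _<ᶠ_ (e≡ i) (e≡ j) (inc (suc i) (suc j) (s≤s i<j)))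
... | suc p = finish k eq
  where
  pos : ∀ i → 0 < toℕ (e i)
  pos zero = subst (λ z → 0 < toℕ z) (sym e0) (s≤s z≤n)
  pos (suc i) = ≤-<-trans z≤n (inc zero (suc i) (s≤s z≤n))
  e′ : Fin (suc r) → Fin n
  e′ i = proj₁ (predecessor (e i) (pos i))
  e≡ : ∀ i → e i ≡ suc (e′ i)
  e≡ i = proj₂ (predecessor (e i) (pos i))
  inc′ : StrictlyIncreasing e′
  inc′ i j i<j = ≤-pred (subst₂ _<ᶠ_ (e≡ i) (e≡ j) (inc i j i<j))
  finish : ∀ k → suc r + k ≡ suc n → ∃ λ (s : Selection (suc r) k (suc n)) → ∀ i → kept s i ≡ e i
  -- With nothing left to drop, `n` equals `r`, and `e′` would inject `suc r` elements into `r`.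
  finish zero eq = ⊥-elim (<-irrefl (trans (sym (+-identityʳ r)) (cong (_∸ 1) eq)) (injective⇒≤ (increasing-injective inc′)))
  finish (suc k) eq with selection {suc r} {k} {n} (trans (sym (+-suc r k)) (cong (_∸ 1) eq)) e′ inc′
  ... | s , s≡ = drop s , λ i → trans (cong suc (s≡ i)) (sym (e≡ i))

selections : ∀ r k n → List (Selection r k n)
selections zero zero zero = [ done ]
selections zero (suc k) (suc n) = map drop (selections zero k n)
selections (suc r) zero (suc n) = map keep (selections r zero n)
selections (suc r) (suc k) (suc n) = map keep (selections r (suc k) n) ++ map drop (selections (suc r) k n)
selections zero zero (suc _) = []
selections zero (suc _) zero = []
selections (suc _) zero zero = []
selections (suc _) (suc _) zero = []

∈-selections : ∀ {r k n} (s : Selection r k n) → s ∈ selections r k n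
∈-selections done = here refl
∈-selections {k = zero} (keep s) = ∈-map⁺ keep (∈-selections s)
∈-selections {k = suc k} (keep s) = ∈-++⁺ˡ (∈-map⁺ keep (∈-selections s))
∈-selections {zero} (drop s) = ∈-map⁺ drop (∈-selections s)
∈-selections {suc r} {suc k} {suc n} (drop s) = ∈-++⁺ʳ (map keep (selections r (suc k) n)) (∈-map⁺ drop (∈-selections s))

keep-injective : ∀ {r k n} {s t : Selection r k n} → keep s ≡ keep t → s ≡ t
keep-injective refl = refl

drop-injective : ∀ {r k n} {s t : Selection r k n} → drop s ≡ drop t → s ≡ t
drop-injective refl = refl

selections-unique : ∀ r k n → Unique (selections r k n)
selections-unique zero zero zero = [] ∷ []
selections-unique zero (suc k) (suc n) = Unique.map⁺ drop-injective (selections-unique zero k n)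
selections-unique (suc r) zero (suc n) = Unique.map⁺ keep-injective (selections-unique r zero n)
selections-unique (suc r) (suc k) (suc n) = Unique.++⁺
  (Unique.map⁺ keep-injective (selections-unique r (suc k) n))
  (Unique.map⁺ drop-injective (selections-unique (suc r) k n))
  disjoint
  where
  disjoint : Disjoint (map keep (selections r (suc k) n)) (map drop (selections (suc r) k n))
  disjoint (∈keep , ∈drop) with ∈-map⁻ keep ∈keep | ∈-map⁻ drop ∈drop
  ... | _ , _ , refl | _ , _ , ()
selections-unique zero zero (suc _) = []
selections-unique zero (suc _) zero = []
selections-unique (suc _) zero zero = []
selections-unique (suc _) (suc _) zero = []

-- Keeping or dropping position 0 yields the two terms of Pascal's rule; `r + k ≡ n` excludes the
-- indices without selections.
length-selections : ∀ r k n → r + k ≡ n → length (selections r k n) ≡ n C k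
length-selections zero zero zero _ = refl
length-selections zero (suc k) (suc .k) refl = trans (length-map drop (selections zero k k))
  (trans (length-selections zero k k refl) (trans (nCn≡1 k) (sym (nCn≡1 (suc k)))))
length-selections (suc r) zero (suc n) eq = trans (length-map keep (selections r zero n))
  (trans (length-selections r zero n (cong (_∸ 1) eq)) (trans (nC0 n) (sym (nC0 (suc n)))))
  where
  nC0 : ∀ n → n C 0 ≡ 1
  nC0 n = trans (nCk≡nC[n∸k] {0} {n} z≤n) (nCn≡1 n)
length-selections (suc r) (suc k) (suc n) eq = trans (length-++ (map keep (selections r (suc k) n)))
  (trans (cong₂ _+_
    (trans (length-map keep (selections r (suc k) n)) (length-selections r (suc k) n (cong (_∸ 1) eq)))
    (trans (length-map drop (selections (suc r) k n))
           (length-selections (suc r) k n (trans (sym (+-suc r k)) (cong (_∸ 1) eq)))))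
  (trans (+-comm (n C suc k) (n C k)) (nCk+nC[k+1]≡[n+1]C[k+1] n k)))

-- Standardization

-- Pigeonhole: punching out a missed value would inject `suc n` elements into `n`.
injective⇒permutation : ∀ {n} (h : Fin n → Fin n) → Injective _≡_ _≡_ h →
                        Σ (Perm n) λ π → ∀ i → π ⟨$⟩ʳ i ≡ h i
injective⇒permutation {n} h inj = permutation h h⁻¹ h∘h⁻¹ (λ i → inj (h∘h⁻¹ (h i))) , λ _ → refl
  where
  surjective : ∀ {n} (h : Fin n → Fin n) → Injective _≡_ _≡_ h → ∀ v → ∃ λ i → h i ≡ v
  surjective {suc n} h inj v with any? (λ i → h i ≟ᶠ v)
  ... | yes hit = hit
  ... | no miss = ⊥-elim (1+n≰n (injective⇒≤ {f = λ i → punchOut (λ v≡hi → miss (i , sym v≡hi))}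
                    λ {i} {j} eq → inj (punchOut-injective {i = v} _ _ eq)))
  h⁻¹ : Fin n → Fin n
  h⁻¹ v = proj₁ (surjective h inj v)
  h∘h⁻¹ : ∀ v → h (h⁻¹ v) ≡ v
  h∘h⁻¹ v = proj₂ (surjective h inj v)

abstract
  -- Each index is sent to the number of smaller values. Later arguments rely only on the order
  -- equivalence, so the construction is opaque.
  standardize : ∀ {r} (h : Fin r → ℕ) → Injective _≡_ _≡_ h →
                Σ (Perm r) λ π → ∀ i j → (π ⟨$⟩ʳ i <ᶠ π ⟨$⟩ʳ j) ⇔ (h i < h j)
  standardize {r} h inj = π , λ i j → mk⇔
    (λ πi<πj → ≰⇒> λ hj≤hi → <⇒≱ (subst₂ _<_ (π≡ i) (π≡ j) πi<πj) (rank-mono-≤ hj≤hi))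
    (λ hi<hj → subst₂ _<_ (sym (π≡ i)) (sym (π≡ j)) (rank-mono hi<hj))
    where
    rank : Fin r → ℕ
    rank i = sum λ l → ⟦ h l <? h i ⟧
    -- Counting `i` together with the entries below it supplies the strictness in `rank-mono` and in
    -- `rank<r`.
    below-and-at : ∀ i → sum (λ l → ⟦ h l <? h i ⟧ + ⟦ l ≟ᶠ i ⟧) ≡ suc (rank i)
    below-and-at i = trans (∑-distrib-+ (λ l → ⟦ h l <? h i ⟧) _)
      (trans (cong (rank i +_) (sum-point i)) (+-comm (rank i) 1))
    rank-mono : ∀ {i j} → h i < h j → rank i < rank j
    rank-mono {i} {j} hi<hj = ≤-trans (≤-reflexive (sym (below-and-at i))) (sum-mono pointwise)
      where
      pointwise : ∀ l → ⟦ h l <? h i ⟧ + ⟦ l ≟ᶠ i ⟧ ≤ ⟦ h l <? h j ⟧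
      pointwise l with l ≟ᶠ i
      ... | yes refl = ≤-reflexive (trans (cong (_+ 1) (⟦⟧-false (h l <? h l) (<-irrefl refl)))
                                          (sym (⟦⟧-true (h l <? h j) hi<hj)))
      ... | no _ = ≤-trans (≤-reflexive (+-identityʳ _))
                           (⟦⟧-mono (h l <? h i) (h l <? h j) (λ hl<hi → <-trans hl<hi hi<hj))
    rank-mono-≤ : ∀ {i j} → h i ≤ h j → rank i ≤ rank j
    rank-mono-≤ {i} {j} hi≤hj =
      sum-mono λ l → ⟦⟧-mono (h l <? h i) (h l <? h j) (λ hl<hi → <-≤-trans hl<hi hi≤hj)
    rank<r : ∀ i → rank i < r
    rank<r i = ≤-trans (≤-reflexive (sym (below-and-at i))) (sum≤size pointwise)
      where
      pointwise : ∀ l → ⟦ h l <? h i ⟧ + ⟦ l ≟ᶠ i ⟧ ≤ 1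
      pointwise l with l ≟ᶠ i
      ... | yes refl = ≤-reflexive (cong (_+ 1) (⟦⟧-false (h l <? h l) (<-irrefl refl)))
      ... | no _ = ≤-trans (≤-reflexive (+-identityʳ _)) (⟦⟧≤1 (h l <? h i))
    rankᶠ : Fin r → Fin r
    rankᶠ i = fromℕ< (rank<r i)
    rankᶠ≡⇒rank≡ : ∀ {i j} → rankᶠ i ≡ rankᶠ j → rank i ≡ rank j
    rankᶠ≡⇒rank≡ {i} {j} eq = trans (sym (toℕ-fromℕ< (rank<r i))) (trans (cong toℕ eq) (toℕ-fromℕ< (rank<r j)))
    rankᶠ-injective : Injective _≡_ _≡_ rankᶠ
    rankᶠ-injective {i} {j} eq with <-cmp (h i) (h j)
    ... | tri< hi<hj _ _ = ⊥-elim (<-irrefl (rankᶠ≡⇒rank≡ eq) (rank-mono hi<hj))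
    ... | tri≈ _ hi≡hj _ = inj hi≡hj
    ... | tri> _ _ hj<hi = ⊥-elim (<-irrefl (sym (rankᶠ≡⇒rank≡ eq)) (rank-mono hj<hi))
    π : Perm r
    π = proj₁ (injective⇒permutation rankᶠ rankᶠ-injective)
    π≡ : ∀ i → coord π i ≡ rank i
    π≡ i = trans (cong toℕ (proj₂ (injective⇒permutation rankᶠ rankᶠ-injective) i)) (toℕ-fromℕ< (rank<r i))

-- The value at `i` is the number of values below it, which only the order determines.
order-determines : ∀ {r} (π τ : Perm r) →
  (∀ i j → (π ⟨$⟩ʳ i <ᶠ π ⟨$⟩ʳ j) ⇔ (τ ⟨$⟩ʳ i <ᶠ τ ⟨$⟩ʳ j)) → π ≈ₚ τ
order-determines π τ same i = toℕ-injective
  (trans (sym (count-coord-below π (coord π i) (<⇒≤ (toℕ<n (π ⟨$⟩ʳ i)))))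
  (trans (sum-cong-≗ λ j → ⟦⟧-cong (coord π j <? coord π i) (coord τ j <? coord τ i)
           (Equivalence.to (same j i)) (Equivalence.from (same j i)))
         (count-coord-below τ (coord τ i) (<⇒≤ (toℕ<n (τ ⟨$⟩ʳ i))))))

-- From breadth to prolificity

module _ {k n : ℕ} (σ : Perm n) (k≤n : k ≤ n) (far : Breadth≥ (k + 2) idₚ σ) where

  private
    Deletion : Set
    Deletion = Selection (n ∸ k) k n

    kept-values : Deletion → Fin (n ∸ k) → ℕ
    kept-values s i = coord σ (kept s i)

    kept-values-injective : ∀ s → Injective _≡_ _≡_ (kept-values s)
    kept-values-injective s eq = increasing-injective (kept-mono s) (coord-injective σ eq)

  pattern-of : Deletion → Perm (n ∸ k)
  pattern-of s = proj₁ (standardize (kept-values s) (kept-values-injective s))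

  pattern-order : ∀ s i j → (pattern-of s ⟨$⟩ʳ i <ᶠ pattern-of s ⟨$⟩ʳ j) ⇔ (kept-values s i < kept-values s j)
  pattern-order s = proj₂ (standardize (kept-values s) (kept-values-injective s))

  -- Equal patterns make `kept s` and `kept t` agree in order along both axes, positions and values,
  -- so `embeddings-agree` applies.
  pattern-injective : ∀ s t → pattern-of s ≈ₚ pattern-of t → s ≡ t
  pattern-injective s t same = kept-injective s t
    (embeddings-agree idₚ σ far (kept s) (kept t) (dropped s) (dropped t) (kept-dropped s) (kept-dropped t)
      (λ i j → mk⇔ (kept-mono t i j ∘ increasing-reflects (kept-mono s) i j)
                   (kept-mono s i j ∘ increasing-reflects (kept-mono t) i j))
      (λ i j → ⇔-trans (⇔-sym (pattern-order s i j)) (⇔-trans (same-order i j) (pattern-order t i j))))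
    where
    same-order : ∀ i j → (pattern-of s ⟨$⟩ʳ i <ᶠ pattern-of s ⟨$⟩ʳ j) ⇔ (pattern-of t ⟨$⟩ʳ i <ᶠ pattern-of t ⟨$⟩ʳ j)
    same-order i j = mk⇔ (subst₂ _<ᶠ_ (same i) (same j)) (subst₂ _<ᶠ_ (sym (same i)) (sym (same j)))

  complete : ∀ π → π ⪯ σ → ∃ λ s → π ≈ₚ pattern-of s
  complete π (e , inc , order) with selection (m∸n+n≡m k≤n) e inc
  ... | s , s≡e = s , order-determines π (pattern-of s) agree
    where
    kept-order : ∀ i j → (coord σ (e i) < coord σ (e j)) ⇔ (kept-values s i < kept-values s j)
    kept-order i j = mk⇔ (subst₂ (λ p q → coord σ p < coord σ q) (sym (s≡e i)) (sym (s≡e j)))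
                         (subst₂ (λ p q → coord σ p < coord σ q) (s≡e i) (s≡e j))
    agree : ∀ i j → (π ⟨$⟩ʳ i <ᶠ π ⟨$⟩ʳ j) ⇔ (pattern-of s ⟨$⟩ʳ i <ᶠ pattern-of s ⟨$⟩ʳ j)
    agree i j = ⇔-trans (order i j) (⇔-trans (kept-order i j) (⇔-sym (pattern-order s i j)))

  breadth⇒prolific : Prolific k n σ
  breadth⇒prolific = map pattern-of all ,
    trans (length-map pattern-of all) (length-selections (n ∸ k) k n (m∸n+n≡m k≤n)) ,
    All.map⁺ (All.tabulate λ {s} _ → kept s , kept-mono s , pattern-order s) ,
    AllPairs.map⁺ (AllPairs.map (λ {s} {t} s≢t same → s≢t (pattern-injective s t same)) (selections-unique (n ∸ k) k n)) ,
    λ π π⪯σ → let (s , π≈s) = complete π π⪯σ in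
      Any.map⁺ (Any.map (λ s≡t → subst (λ t → π ≈ₚ pattern-of t) s≡t π≈s) (∈-selections s))
    where
    all = selections (n ∸ k) k n

-- Distance estimates in arithmetic form

module Distances (c h q q′ δ ε : ℕ) (c≤h : c ≤ h) where

  private
    s : ℕ
    s = suc (2 * c)

  -- In this module `q` and `q′` are the quotients of two values modulo `s`; `δ` bounds the
  -- difference of the values and `ε` that of their positions. The gap hypothesis bounds `ε` below
  -- by its constant plus `q − q′`. So `ε` shrinks only as `q′` outgrows `q`, and each such unit
  -- adds `s` to `δ`.
  three-apart : ∀ t t′ → 1 ≤ c → t ≤ 2 * c → q + (h + h + h) ≤ q′ + ε →
    t′ + q′ * s ≤ t + q * s + δ → c + h + 1 ≤ δ + ε
  three-apart t t′ 1≤c t≤2c gap W≤V+δ with ≤-<-connex q′ q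
  ... | inj₁ q′≤q with m≤n⇒∃[o]m+o≡n q′≤q
  ...   | e , refl = linear (δ + e) (+-mono-≤ gap (+-mono-≤ c≤h (≤-trans 1≤c c≤h))) (eq c h q′ δ ε e)
    where
    eq : ∀ c h q δ ε e → c + h + 1 + (q + ε + (h + h)) + (δ + e) ≡ δ + ε + (q + e + (h + h + h) + (c + 1))
    eq = solve-∀
  three-apart t t′ 1≤c t≤2c gap W≤V+δ | inj₂ q<q′ with m≤n⇒∃[o]m+o≡n q<q′
  ...   | e , refl = linear (t′ + 2 * (c * e))
            (+-mono-≤ (+-mono-≤ gap W≤V+δ) (+-mono-≤ t≤2c (+-mono-≤ c≤h (≤-trans 1≤c c≤h))))
            (eq c h q δ ε e t t′)
    where
    eq : ∀ c h q δ ε e t t′ →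
      c + h + 1 + (suc (q + e) + ε + (t + q * suc (2 * c) + δ) + (2 * c + (h + h))) + (t′ + 2 * (c * e))
      ≡ δ + ε + (q + (h + h + h) + (t′ + suc (q + e) * suc (2 * c)) + (t + (c + 1)))
    eq = solve-∀

  two-apart : ∀ t → q + (h + suc h) ≤ q′ + ε →
    suc t + q′ * s ≤ t + q * s + δ → c + h + 1 ≤ δ + ε
  two-apart t gap W≤V+δ with ≤-<-connex q′ q
  ... | inj₁ q′≤q with m≤n⇒∃[o]m+o≡n q′≤q
  ...   | e , refl = linear (δ + e) (+-mono-≤ gap c≤h) (eq c h q′ δ ε e)
    where
    eq : ∀ c h q δ ε e → c + h + 1 + (q + ε + h) + (δ + e) ≡ δ + ε + (q + e + (h + suc h) + c)
    eq = solve-∀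
  two-apart t gap W≤V+δ | inj₂ q<q′ with m≤n⇒∃[o]m+o≡n q<q′
  ...   | e , refl = linear (1 + 2 * c + 2 * (c * e)) (+-mono-≤ (+-mono-≤ gap W≤V+δ) c≤h) (eq c h q δ ε e t)
    where
    eq : ∀ c h q δ ε e t →
      c + h + 1 + (suc (q + e) + ε + (t + q * suc (2 * c) + δ) + h) + (1 + 2 * c + 2 * (c * e))
      ≡ δ + ε + (q + (h + suc h) + (suc t + suc (q + e) * suc (2 * c)) + c)
    eq = solve-∀

  -- Adjacent classes are the tight case: `q′ = q` gives `δ ≥ c + 1` and `ε ≥ h`, while `q′ = q − 1`
  -- gives `δ ≥ c` and `ε ≥ h + 1`.
  ascent : ∀ t → q + h ≤ q′ + ε → t + suc c + q′ * s ≤ t + q * s + δ →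
    t + q * s ≤ t + suc c + q′ * s + δ → c + h + 1 ≤ δ + ε
  ascent t gap W≤V+δ V≤W+δ with ≤-<-connex q q′
  ... | inj₁ q≤q′ with m≤n⇒∃[o]m+o≡n q≤q′
  ...   | e , refl = linear (2 * (c * e)) (+-mono-≤ gap W≤V+δ) (eq c h q δ ε e t)
    where
    eq : ∀ c h q δ ε e t →
      c + h + 1 + (q + e + ε + (t + q * suc (2 * c) + δ)) + 2 * (c * e)
      ≡ δ + ε + (q + h + (t + suc c + (q + e) * suc (2 * c)))
    eq = solve-∀
  ascent t gap W≤V+δ V≤W+δ | inj₂ q′<q with m≤n⇒∃[o]m+o≡n q′<q
  ...   | e , refl = linear (2 * e + 2 * (c * e)) (+-mono-≤ gap V≤W+δ) (eq c h q′ δ ε e t)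
    where
    eq : ∀ c h q δ ε e t →
      c + h + 1 + (q + ε + (t + suc c + q * suc (2 * c) + δ)) + (2 * e + 2 * (c * e))
      ≡ δ + ε + (suc (q + e) + h + (t + suc (q + e) * suc (2 * c)))
    eq = solve-∀

  -- Here the residues differ by `c` only, which the larger gap `suc h` makes up for.
  descent : ∀ t → q + suc h ≤ q′ + ε → t + q′ * s ≤ c + t + q * s + δ →
    c + t + q * s ≤ t + q′ * s + δ → c + h + 1 ≤ δ + ε
  descent t gap W≤V+δ V≤W+δ with ≤-<-connex q′ q
  ... | inj₁ q′≤q with m≤n⇒∃[o]m+o≡n q′≤q
  ...   | e , refl = linear (2 * e + 2 * (c * e)) (+-mono-≤ gap V≤W+δ) (eq c h q′ δ ε e t)
    where
    eq : ∀ c h q δ ε e t →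
      c + h + 1 + (q + ε + (t + q * suc (2 * c) + δ)) + (2 * e + 2 * (c * e))
      ≡ δ + ε + (q + e + suc h + (c + t + (q + e) * suc (2 * c)))
    eq = solve-∀
  descent t gap W≤V+δ V≤W+δ | inj₂ q<q′ with m≤n⇒∃[o]m+o≡n q<q′
  ...   | e , refl = linear (2 * (c * e)) (+-mono-≤ gap W≤V+δ) (eq c h q δ ε e t)
    where
    eq : ∀ c h q δ ε e t →
      c + h + 1 + (suc (q + e) + ε + (c + t + q * suc (2 * c) + δ)) + 2 * (c * e)
      ≡ δ + ε + (q + suc h + (t + suc (q + e) * suc (2 * c)))
    eq = solve-∀

-- Values of one class differ by at least `2c + 1`, and their positions by 1; `h ≤ c + 1` makes the
-- total suffice.
same-class : ∀ {c h} q q′ δ ε t → h ≤ suc c → q < q′ → 1 ≤ ε →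
  t + q′ * suc (2 * c) ≤ t + q * suc (2 * c) + δ → c + h + 1 ≤ δ + ε
same-class {c} {h} q q′ δ ε t h≤1+c q<q′ 1≤ε W≤V+δ with m≤n⇒∃[o]m+o≡n q<q′
... | e , refl = linear (e * suc (2 * c)) (+-mono-≤ W≤V+δ (+-mono-≤ 1≤ε h≤1+c)) (eq c h q δ ε e t)
  where
  eq : ∀ c h q δ ε e t →
    c + h + 1 + (t + q * suc (2 * c) + δ + (ε + suc c)) + e * suc (2 * c)
    ≡ δ + ε + (t + suc (q + e) * suc (2 * c) + (1 + h))
  eq = solve-∀

-- The construction and its breadth

-- The `2c + 1` residues comprise `c` low and `c + 1` high ones, which alternate in the arrangement.
data Place : Set where
  low high : ℕ → Place

module Construction (c h n : ℕ) (1≤c : 1 ≤ c) (c≤h : c ≤ h) (h≤1+c : h ≤ suc c)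
                    (large : h * suc (2 * c) + c ≤ n) where

  s : ℕ
  s = suc (2 * c)

  residue : Place → ℕ
  residue (low u) = u
  residue (high u) = c + u

  place : ℕ → Place
  place t with t <? c
  ... | yes _ = low t
  ... | no _ = high (t ∸ c)

  Valid : Place → Set
  Valid (low u) = u < c
  Valid (high u) = u ≤ c

  residue≤2c : ∀ p → Valid p → residue p ≤ 2 * c
  residue≤2c (low u) u<c = ≤-trans (<⇒≤ u<c) (m≤m+n c _)
  residue≤2c (high u) u≤c = +-monoʳ-≤ c (≤-trans u≤c (≤-reflexive (sym (+-identityʳ c))))

  place-valid : ∀ t → t ≤ 2 * c → Valid (place t)
  place-valid t t≤2c with t <? c
  ... | yes t<c = t<c
  ... | no _ = ≤-trans (∸-monoˡ-≤ c t≤2c) (≤-reflexive (trans (m+n∸m≡n c (c + 0)) (+-identityʳ c)))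

  residue-place : ∀ t → residue (place t) ≡ t
  residue-place t with t <? c
  ... | yes _ = refl
  ... | no t≮c = m+[n∸m]≡n (≮⇒≥ t≮c)

  place-residue : ∀ p → Valid p → place (residue p) ≡ p
  place-residue (low u) u<c with u <? c
  ... | yes _ = refl
  ... | no u≮c = ⊥-elim (u≮c u<c)
  place-residue (high u) u≤c with c + u <? c
  ... | yes c+u<c = ⊥-elim (m+n≮m c u c+u<c)
  ... | no _ = cong high (m+n∸m≡n c u)

  -- The residue classes are arranged in the order c, 0, c+1, 1, …, 2c−1, c−1, 2c.
  ord : Place → ℕ
  ord (low u) = suc (2 * u)
  ord (high u) = 2 * u

  _≺_ : Place → Place → Set
  low u ≺ low v = u < v
  low u ≺ high v = u < v
  high u ≺ low v = u ≤ v
  high u ≺ high v = u < v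

  2*-mono-< : ∀ {u v} → u < v → suc (2 * u) < 2 * v
  2*-mono-< {u} {v} u<v = ≤-trans (≤-reflexive (eq u)) (*-monoʳ-≤ 2 u<v)
    where
    eq : ∀ u → suc (suc (2 * u)) ≡ 2 * suc u
    eq = solve-∀

  ord-mono : ∀ p p′ → p ≺ p′ → ord p < ord p′
  ord-mono (low u) (low v) u<v = m<n⇒m<1+n (2*-mono-< u<v)
  ord-mono (low u) (high v) u<v = 2*-mono-< u<v
  ord-mono (high u) (low v) u≤v = s≤s (*-monoʳ-≤ 2 u≤v)
  ord-mono (high u) (high v) u<v = <-trans (n<1+n _) (2*-mono-< u<v)

  compare : ∀ p p′ → p ≺ p′ ⊎ p ≡ p′ ⊎ p′ ≺ p
  compare (low u) (low v) with <-cmp u v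
  ... | tri< lt _ _ = inj₁ lt
  ... | tri≈ _ refl _ = inj₂ (inj₁ refl)
  ... | tri> _ _ gt = inj₂ (inj₂ gt)
  compare (high u) (high v) with <-cmp u v
  ... | tri< lt _ _ = inj₁ lt
  ... | tri≈ _ refl _ = inj₂ (inj₁ refl)
  ... | tri> _ _ gt = inj₂ (inj₂ gt)
  compare (low u) (high v) with ≤-<-connex v u
  ... | inj₁ v≤u = inj₂ (inj₂ v≤u)
  ... | inj₂ u<v = inj₁ u<v
  compare (high u) (low v) with ≤-<-connex u v
  ... | inj₁ u≤v = inj₁ u≤v
  ... | inj₂ v<u = inj₂ (inj₂ v<u)

  -- Lexicographic order by class and then by decreasing quotient, in base `suc n` because
  -- `n ∸ q ≤ n`.
  key : Place → ℕ → ℕ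
  key p q = ord p * suc n + (n ∸ q)

  key-mono-≺ : ∀ p q p′ q′ → p ≺ p′ → key p q < key p′ q′
  key-mono-≺ p q p′ q′ p≺p′ = begin-strict
    ord p * suc n + (n ∸ q)   <⟨ +-monoʳ-< (ord p * suc n) (s≤s (m∸n≤m n q)) ⟩
    ord p * suc n + suc n     ≡⟨ +-comm (ord p * suc n) (suc n) ⟩
    suc (ord p) * suc n       ≤⟨ *-monoˡ-≤ (suc n) (ord-mono p p′ p≺p′) ⟩
    ord p′ * suc n            ≤⟨ m≤m+n _ _ ⟩
    ord p′ * suc n + (n ∸ q′) ∎
    where open ≤-Reasoning

  key-mono-> : ∀ p q q′ → q′ < q → q ≤ n → key p q < key p q′
  key-mono-> p q q′ q′<q q≤n = +-monoʳ-< (ord p * suc n) (∸-monoʳ-< q′<q q≤n)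

  placeᵛ : Fin n → Place
  placeᵛ v = place (toℕ v % s)

  quotient : Fin n → ℕ
  quotient v = toℕ v / s

  value : ∀ v → toℕ v ≡ residue (placeᵛ v) + quotient v * s
  value v = trans (m≡m%n+[m/n]*n (toℕ v) s) (cong (_+ quotient v * s) (sym (residue-place (toℕ v % s))))

  placeᵛ-valid : ∀ v → Valid (placeᵛ v)
  placeᵛ-valid v = place-valid (toℕ v % s) (≤-pred (m%n<n (toℕ v) s))

  quotient≤n : ∀ v → quotient v ≤ n
  quotient≤n v = ≤-trans (m/n≤m (toℕ v) s) (<⇒≤ (toℕ<n v))

  keyᵛ : Fin n → ℕ
  keyᵛ v = key (placeᵛ v) (quotient v)

  keyᵛ-injective : Injective _≡_ _≡_ keyᵛ
  keyᵛ-injective {v} {w} eq with compare (placeᵛ v) (placeᵛ w)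
  ... | inj₁ lt = ⊥-elim (<-irrefl eq (key-mono-≺ (placeᵛ v) (quotient v) (placeᵛ w) (quotient w) lt))
  ... | inj₂ (inj₂ gt) = ⊥-elim (<-irrefl (sym eq) (key-mono-≺ (placeᵛ w) (quotient w) (placeᵛ v) (quotient v) gt))
  ... | inj₂ (inj₁ same) with <-cmp (quotient v) (quotient w)
  ...   | tri< lt _ _ = ⊥-elim (<-irrefl (sym eq) (subst (λ p → keyᵛ w < key p (quotient v)) (sym same)
                          (key-mono-> (placeᵛ w) (quotient w) (quotient v) lt (quotient≤n w))))
  ...   | tri≈ _ q≡ _ = toℕ-injective (trans (value v)
                          (trans (cong₂ (λ p q → residue p + q * s) same q≡) (sym (value w))))
  ...   | tri> _ _ gt = ⊥-elim (<-irrefl eq (subst (λ p → keyᵛ v < key p (quotient w)) same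
                          (key-mono-> (placeᵛ v) (quotient v) (quotient w) gt (quotient≤n v))))

  -- It sends a value to its position in the list, so it is the inverse of the listed word;
  -- exchanging the axes preserves breadth.
  σ : Perm n
  σ = proj₁ (standardize keyᵛ keyᵛ-injective)

  σ-mono : ∀ v w → keyᵛ v < keyᵛ w → coord σ v < coord σ w
  σ-mono v w = Equivalence.from (proj₂ (standardize keyᵛ keyᵛ-injective) v w)

  -- Naming points by class and quotient gives direct access to the ends of a class, which serve as
  -- intermediate points.
  record Inside (p : Place) (q : ℕ) : Set where
    constructor _,_
    field
      valid : Valid p
      bounded : residue p + q * s < n

  open Inside

  point : ∀ {p q} → Inside p q → Fin n
  point (_ , lt) = fromℕ< lt

  keyᵛ-point : ∀ {p q} (i : Inside p q) → keyᵛ (point i) ≡ key p q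
  keyᵛ-point {p} {q} (v , lt) = cong₂ key
    (trans (cong place (trans (cong (_% s) (toℕ-fromℕ< lt)) rem)) (place-residue p v))
    (trans (cong (_/ s) (toℕ-fromℕ< lt)) quot)
    where
    t<s : residue p < s
    t<s = s≤s (residue≤2c p v)
    rem : (residue p + q * s) % s ≡ residue p
    rem = trans ([m+kn]%n≡m%n (residue p) q s) (m<n⇒m%n≡m t<s)
    quot : (residue p + q * s) / s ≡ q
    quot = trans (+-distrib-/-∣ʳ (residue p) (n∣m*n q)) (cong₂ _+_ (m<n⇒m/n≡0 t<s) (m*n/n≡m q s))

  position : ∀ {p q} → Inside p q → ℕ
  position i = coord σ (point i)

  q≤n : ∀ {p q} → Inside p q → q ≤ n
  q≤n {p} {q} (_ , lt) = begin
    q                   ≤⟨ m≤m*n q s ⟩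
    q * s               ≤⟨ m≤n+m _ _ ⟩
    residue p + q * s   ≤⟨ <⇒≤ lt ⟩
    n                   ∎
    where open ≤-Reasoning

  position-≺ : ∀ {p q p′ q′} (i : Inside p q) (i′ : Inside p′ q′) → p ≺ p′ → position i < position i′
  position-≺ {p} {q} {p′} {q′} i i′ p≺p′ = σ-mono (point i) (point i′)
    (subst₂ _<_ (sym (keyᵛ-point i)) (sym (keyᵛ-point i′)) (key-mono-≺ p q p′ q′ p≺p′))

  inside-smaller : ∀ {p q q′} → q′ ≤ q → Inside p q → Inside p q′
  inside-smaller {p} q′≤q (v , lt) = v , ≤-<-trans (+-monoʳ-≤ (residue p) (*-monoˡ-≤ s q′≤q)) lt

  -- Each unit by which the quotient drops leads to a strictly later member of the class.
  position-antitone : ∀ {p q q′} (i : Inside p q) (i′ : Inside p q′) → q′ ≤ q →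
                      position i + q ≤ position i′ + q′
  position-antitone {p} {q} i i′ q′≤q with m≤n⇒m<n∨m≡n q′≤q
  ... | inj₂ refl = ≤-refl
  position-antitone {p} {suc r} {q′} i i′ _ | inj₁ (s≤s q′≤r) = begin
    position i + suc r       ≡⟨ +-suc (position i) r ⟩
    suc (position i) + r     ≤⟨ +-monoˡ-≤ r (σ-mono (point i) (point i″)
      (subst₂ _<_ (sym (keyᵛ-point i)) (sym (keyᵛ-point i″)) (key-mono-> p (suc r) r (n<1+n r) (q≤n i)))) ⟩
    position i″ + r          ≤⟨ position-antitone i″ i′ q′≤r ⟩
    position i′ + q′         ∎
    where
    open ≤-Reasoning
    i″ : Inside p r
    i″ = inside-smaller (n≤1+n r) i

  -- `position i + q` is at most the position of the last member of class `p`, the one with quotient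
  -- 0. After it come the members of class `p′`, at least `suc g` in number.
  gap : ∀ {p q p′ q′} g (i : Inside p q) (i′ : Inside p′ q′) → Inside p′ g → p ≺ p′ →
        position i + q + suc g ≤ position i′ + q′
  gap {p} {q} {p′} {q′} g i i′ top p≺p′ = ≤-trans
    (+-monoˡ-≤ (suc g) (position-antitone i bottom z≤n)) (≤-trans (≤-reflexive (eq (position bottom) g)) after)
    where
    eq : ∀ a g → a + 0 + suc g ≡ suc a + g
    eq = solve-∀
    bottom : Inside p 0
    bottom = inside-smaller z≤n i
    after : suc (position bottom) + g ≤ position i′ + q′
    after with ≤-total q′ g
    ... | inj₁ q′≤g = ≤-trans (+-monoˡ-≤ g (position-≺ bottom top p≺p′)) (position-antitone top i′ q′≤g)
    ... | inj₂ g≤q′ = +-mono-≤ (position-≺ bottom i′ p≺p′) g≤q′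

  1≤h : 1 ≤ h
  1≤h = ≤-trans 1≤c c≤h

  -- Here and in `any-top` the size bound enters: every class has at least `h` members, and each low
  -- class one more.
  low-top : ∀ {u} → u < c → Inside (low u) h
  low-top {u} u<c = u<c , <-≤-trans (+-monoˡ-< (h * s) u<c) (≤-trans (≤-reflexive (+-comm c (h * s))) large)

  any-top : ∀ {p} → Valid p → Inside p (h ∸ 1)
  any-top {p} v = v , (begin-strict
    residue p + (h ∸ 1) * s   <⟨ +-monoˡ-< ((h ∸ 1) * s) (s≤s (residue≤2c p v)) ⟩
    suc (h ∸ 1) * s           ≡⟨ cong (_* s) (m+[n∸m]≡n 1≤h) ⟩
    h * s                     ≤⟨ m≤m+n _ c ⟩
    h * s + c                 ≤⟨ large ⟩
    n                         ∎)
    where open ≤-Reasoning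

  gap-any : ∀ {p q p′ q′} (i : Inside p q) (i′ : Inside p′ q′) → p ≺ p′ →
            position i + q + h ≤ position i′ + q′
  gap-any {p} {q} {p′} {q′} i i′ p≺p′ =
    subst (λ g → position i + q + g ≤ position i′ + q′) (m+[n∸m]≡n 1≤h)
      (gap (h ∸ 1) i i′ (any-top (valid i′)) p≺p′)

  gap-low : ∀ {p q u q′} (i : Inside p q) (i′ : Inside (low u) q′) → p ≺ low u →
            position i + q + suc h ≤ position i′ + q′
  gap-low i i′ = gap h i i′ (low-top (valid i′))

  first : ∀ p → Valid p → Inside p 0
  first p v = inside-smaller z≤n (any-top v)

  gap-trans : ∀ a g g′ {m b} → a + g ≤ m → m + g′ ≤ b → a + (g + g′) ≤ b
  gap-trans a g g′ a+g≤m m+g′≤b =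
    ≤-trans (≤-reflexive (sym (+-assoc a g g′))) (≤-trans (+-monoˡ-≤ g′ a+g≤m) m+g′≤b)

  gap-three : ∀ {p q p′ q′} p₁ p₂ → Valid p₁ → Valid p₂ → (i : Inside p q) (i′ : Inside p′ q′) →
    p ≺ p₁ → p₁ ≺ p₂ → p₂ ≺ p′ → position i + q + (h + h + h) ≤ position i′ + q′
  gap-three {q = q} p₁ p₂ v₁ v₂ i i′ lt₁ lt₂ lt₃ = gap-trans (position i + q) (h + h) h
    (gap-trans (position i + q) h h (gap-any i i₁ lt₁) (gap-any i₁ i₂ lt₂)) (gap-any i₂ i′ lt₃)
    where
    i₁ = first p₁ v₁
    i₂ = first p₂ v₂

  module _ {q q′ δ ε : ℕ} where

    open Distances c h q q′ δ ε c≤h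

    cancel-position : ∀ {a b G} → b ≤ a + ε → a + q + G ≤ b + q′ → q + G ≤ q′ + ε
    cancel-position {a} {b} {G} b≤a+ε le = linear 0 (+-mono-≤ b≤a+ε le) (eq a b G q q′ ε)
      where
      eq : ∀ a b G q q′ ε → q + G + (a + ε + (b + q′)) + 0 ≡ q′ + ε + (b + (a + q + G))
      eq = solve-∀

    -- Adjacent classes use `ascent` or `descent`. Going two classes on enters one low and one high
    -- class, whence a gap of `2h + 1` for `two-apart`. Anything further passes two intermediate
    -- classes and falls under `three-apart`.
    separated : ∀ p p′ → p ≺ p′ → (i : Inside p q) (i′ : Inside p′ q′) →
      residue p′ + q′ * s ≤ residue p + q * s + δ →
      residue p + q * s ≤ residue p′ + q′ * s + δ →
      position i′ ≤ position i + ε → c + h + 1 ≤ δ + ε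
    separated (low u) (low v) u<v i i′ W≤ V≤ ε-bound with m≤n⇒m<n∨m≡n u<v
    ... | inj₂ refl = two-apart u (cancel-position ε-bound
            (gap-trans (position i + q) h (suc h) (gap-any i mid (n<1+n u)) (gap-low mid i′ ≤-refl))) W≤
      where mid = first (high (suc u)) (<⇒≤ (valid i′))
    ... | inj₁ 1+u<v = three-apart u v 1≤c (residue≤2c (low u) (valid i)) (cancel-position ε-bound
            (gap-three (high (suc u)) (low (suc u)) (<⇒≤ (<-trans 1+u<v (valid i′))) (<-trans 1+u<v (valid i′))
              i i′ (n<1+n u) ≤-refl 1+u<v)) W≤
    separated (high u) (high v) u<v i i′ W≤ V≤ ε-bound with m≤n⇒m<n∨m≡n u<v
    ... | inj₂ refl = two-apart (c + u) (cancel-position ε-bound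
            (subst (λ g → position i + q + g ≤ position i′ + q′) (+-comm (suc h) h)
              (gap-trans (position i + q) (suc h) h (gap-low i mid ≤-refl) (gap-any mid i′ (n<1+n u)))))
            (subst (λ t → t + q′ * s ≤ c + u + q * s + δ) (+-suc c u) W≤)
      where mid = first (low u) (valid i′)
    ... | inj₁ 1+u<v = three-apart (c + u) (c + v) 1≤c (residue≤2c (high u) (valid i)) (cancel-position ε-bound
            (gap-three (low u) (high (suc u)) (<-≤-trans u<v (valid i′)) (≤-trans u<v (valid i′))
              i i′ ≤-refl (n<1+n u) 1+u<v)) W≤
    separated (low u) (high v) u<v i i′ W≤ V≤ ε-bound with m≤n⇒m<n∨m≡n u<v
    ... | inj₂ refl = ascent u (cancel-position ε-bound (gap-any i i′ u<v))
            (subst (λ t → t + q′ * s ≤ u + q * s + δ) (eq c u) W≤)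
            (subst (λ t → u + q * s ≤ t + q′ * s + δ) (eq c u) V≤)
      where
      eq : ∀ c u → c + suc u ≡ u + suc c
      eq = solve-∀
    ... | inj₁ 1+u<v = three-apart u (c + v) 1≤c (residue≤2c (low u) (valid i)) (cancel-position ε-bound
            (gap-three (high (suc u)) (low (suc u)) (≤-trans u<v (valid i′)) (<-≤-trans 1+u<v (valid i′))
              i i′ (n<1+n u) ≤-refl 1+u<v)) W≤
    separated (high u) (low v) u≤v i i′ W≤ V≤ ε-bound with m≤n⇒m<n∨m≡n u≤v
    ... | inj₂ refl = descent u (cancel-position ε-bound (gap-low i i′ u≤v)) W≤ V≤
    ... | inj₁ u<v = three-apart (c + u) v 1≤c (residue≤2c (high u) (valid i)) (cancel-position ε-bound
            (gap-three (low u) (high (suc u)) (<-trans u<v (valid i′)) (<⇒≤ (≤-<-trans u<v (valid i′)))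
              i i′ ≤-refl (n<1+n u) u<v)) W≤

  inside : ∀ v → Inside (placeᵛ v) (quotient v)
  inside v = placeᵛ-valid v , subst (_< n) (value v) (toℕ<n v)

  position-inside : ∀ v → position (inside v) ≡ coord σ v
  position-inside v = cong (coord σ) (toℕ-injective (trans (toℕ-fromℕ< (bounded (inside v))) (sym (value v))))

  value-bound : ∀ v w → residue (placeᵛ w) + quotient w * s
                      ≤ residue (placeᵛ v) + quotient v * s + ∣ toℕ v - toℕ w ∣
  value-bound v w = subst₂ (λ W V → W ≤ V + ∣ toℕ v - toℕ w ∣) (value w) (value v) (m≤n+∣n-m∣ (toℕ w) (toℕ v))

  distance : Fin n → Fin n → ℕ
  distance v w = ∣ toℕ v - toℕ w ∣ + ∣ coord σ v - coord σ w ∣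

  distance-comm : ∀ v w → distance v w ≡ distance w v
  distance-comm v w = cong₂ _+_ (∣-∣-comm (toℕ v) (toℕ w)) (∣-∣-comm (coord σ v) (coord σ w))

  distance-≺ : ∀ v w → placeᵛ v ≺ placeᵛ w → c + h + 1 ≤ distance v w
  distance-≺ v w v≺w = separated (placeᵛ v) (placeᵛ w) v≺w (inside v) (inside w)
    (value-bound v w)
    (subst (λ d → residue (placeᵛ v) + quotient v * s ≤ residue (placeᵛ w) + quotient w * s + d)
      (∣-∣-comm (toℕ w) (toℕ v)) (value-bound w v))
    (subst₂ (λ a b → b ≤ a + ∣ coord σ v - coord σ w ∣) (sym (position-inside v)) (sym (position-inside w))
      (m≤n+∣n-m∣ (coord σ w) (coord σ v)))

  distance-same : ∀ v w → placeᵛ v ≡ placeᵛ w → quotient v < quotient w → v ≢ w → c + h + 1 ≤ distance v w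
  distance-same v w same v<w v≢w = same-class (quotient v) (quotient w) _ _ (residue (placeᵛ v)) h≤1+c v<w
    (n≢0⇒n>0 λ zero-gap → v≢w (coord-injective σ (∣m-n∣≡0⇒m≡n zero-gap)))
    (subst (λ p → residue p + quotient w * s ≤ residue (placeᵛ v) + quotient v * s + ∣ toℕ v - toℕ w ∣)
      (sym same) (value-bound v w))

  σ-breadth : Breadth≥ (c + h + 1) idₚ σ
  σ-breadth v w v≢w with compare (placeᵛ v) (placeᵛ w)
  ... | inj₁ v≺w = distance-≺ v w v≺w
  ... | inj₂ (inj₂ w≺v) = subst (c + h + 1 ≤_) (distance-comm w v) (distance-≺ w v w≺v)
  ... | inj₂ (inj₁ same) with <-cmp (quotient v) (quotient w)
  ...   | tri< v<w _ _ = distance-same v w same v<w v≢w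
  ...   | tri> _ _ w<v = subst (c + h + 1 ≤_) (distance-comm w v) (distance-same w v (sym same) w<v (v≢w ∘ sym))
  ...   | tri≈ _ q≡ _ = ⊥-elim (v≢w (toℕ-injective (trans (value v)
                          (trans (cong₂ (λ p q → residue p + q * s) same q≡) (sym (value w))))))

-- Choice of parameters

parity : ∀ k → (∃ λ j → k ≡ 2 * j) ⊎ (∃ λ j → k ≡ suc (2 * j))
parity zero = inj₁ (0 , refl)
parity (suc k) with parity k
... | inj₁ (j , refl) = inj₂ (j , refl)
... | inj₂ (j , refl) = inj₁ (suc j , eq j)
  where
  eq : ∀ j → suc (suc (2 * j)) ≡ 2 * suc j
  eq = solve-∀

m*2≤n⇒m≤n/2 : ∀ m n → m * 2 ≤ n → m ≤ n / 2
m*2≤n⇒m≤n/2 m n m*2≤n = ≤-trans (≤-reflexive (sym (m*n/n≡m m 2))) (/-monoˡ-≤ 2 m*2≤n)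

bound⇒k≤n : ∀ k n → (k * k + 1) / 2 + 2 * k + 1 ≤ n → k ≤ n
bound⇒k≤n k n = ≤-trans (≤-trans (m≤m+n k (k + 0)) (≤-trans (m≤n+m (2 * k) ((k * k + 1) / 2)) (m≤m+n _ 1)))

-- k = 2j uses (c, h) = (j, j+1), and k = 2j+1 uses (c, h) = (j+1, j+1).
theorem4p5 : (k : ℕ) → 1 ≤ k → (n : ℕ) → (k * k + 1) / 2 + 2 * k + 1 ≤ n →
    Σ (Perm n) (λ σ → Prolific k n σ)
theorem4p5 k 1≤k n bound with parity k
... | inj₁ (j , refl) = σ , breadth⇒prolific {2 * j} σ (bound⇒k≤n (2 * j) n bound) (subst (λ d → Breadth≥ d idₚ σ) (eq j) σ-breadth)
  where
  1≤j : 1 ≤ j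
  1≤j = n≢0⇒n>0 λ { refl → <⇒≱ 1≤k z≤n }
  eq : ∀ j → j + suc j + 1 ≡ 2 * j + 2
  eq = solve-∀
  -- For these `c` and `h` the size required by the construction equals the bound of the theorem
  -- exactly.
  size : ∀ j → suc j * suc (2 * j) + j ≡ 2 * (j * j) + 2 * (2 * j) + 1
  size = solve-∀
  -- Here `k * k` is even, and the added 1 disappears in the halving.
  half : ∀ j → 2 * (j * j) * 2 + 1 ≡ 2 * j * (2 * j) + 1
  half = solve-∀
  large : suc j * suc (2 * j) + j ≤ n
  large = ≤-trans (≤-reflexive (size j)) (≤-trans (+-monoˡ-≤ 1 (+-monoˡ-≤ (2 * (2 * j))
    (m*2≤n⇒m≤n/2 (2 * (j * j)) _ (≤-trans (m≤m+n _ 1) (≤-reflexive (half j)))))) bound)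
  open Construction j (suc j) n 1≤j (n≤1+n j) ≤-refl large
... | inj₂ (j , refl) = σ , breadth⇒prolific {suc (2 * j)} σ (bound⇒k≤n (suc (2 * j)) n bound) (subst (λ d → Breadth≥ d idₚ σ) (eq j) σ-breadth)
  where
  eq : ∀ j → suc j + suc j + 1 ≡ suc (2 * j) + 2
  eq = solve-∀
  size : ∀ j → suc j * suc (2 * suc j) + suc j ≡ suc (2 * (j * j) + 2 * j) + 2 * suc (2 * j) + 1
  size = solve-∀
  -- Here `k * k` is odd, and halving `k * k + 1` is exact.
  half : ∀ j → suc (2 * (j * j) + 2 * j) * 2 ≡ suc (2 * j) * suc (2 * j) + 1
  half = solve-∀
  large : suc j * suc (2 * suc j) + suc j ≤ n
  large = ≤-trans (≤-reflexive (size j)) (≤-trans (+-monoˡ-≤ 1 (+-monoˡ-≤ (2 * suc (2 * j))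
    (m*2≤n⇒m≤n/2 (suc (2 * (j * j) + 2 * j)) _ (≤-reflexive (half j))))) bound)
  open Construction (suc j) (suc j) n (s≤s z≤n) ≤-refl (n≤1+n (suc j)) large
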